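{- Let $\Sigma=\{\alpha_1,\alpha_2,\dots\}$ be an infinite countable alphabet, $\upsilon\notin\Sigma$ a variable, $\vec k=(k_n)_{n\in\mathbb N}\subseteq\mathbb N$ an increasing sequence and $r,s\in\mathbb N$. If $W(\Sigma,\vec k;\upsilon)=A_1\cup\dots\cup A_r$ and $W(\Sigma,\vec k)=C_1\cup\dots\cup C_s$, then there exist a sequence $(u_n)_{n\in\mathbb N}\in W^\infty(\Sigma,\vec k;\upsilon)$ and $1\le i_0\le r$, $1\le j_0\le s$ such that $T_{p_1}(u_{n_1})\star\cdots\star T_{p_\lambda}(u_{n_\lambda})\in A_{i_0}$ for every $\lambda\in\mathbb N$, $n_1<\dots<n_\lambda$ in $\mathbb N$ and $p_1,\dots,p_\lambda\in\mathbb N\cup\{0\}$ with $0\le p_i\le k_{n_i}$ for all $i$ and $0\in\{p_1,\dots,p_\lambda\}$; and $T_{p_1}(u_{n_1})\star\cdots\star T_{p_\lambda}(u_{n_\lambda})\in C_{j_0}$ for every $\lambda\in\mathbb N$, $n_1<\dots<n_\lambda$ in $\mathbb N$ and $p_1,\dots,p_\lambda\in\mathbb N$ with $1\le p_i\le k_{n_i}$ for all $i$.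
   Context: $\mathbb N=\{1,2,\dots\}$. $W(\Sigma,\vec k)$ is the set of words $w=w_1\dots w_l$ ($l\in\mathbb N$) with $w_i\in\{\alpha_1,\dots,\alpha_{k_i}\}$ for each $i$; $W(\Sigma,\vec k;\upsilon)$ is the set of words $w=w_1\dots w_l$ with $w_i\in\{\upsilon,\alpha_1,\dots,\alpha_{k_i}\}$ for each $i$ and $w_i=\upsilon$ for at least one $i$. For $w=w_1\dots w_l$, $u=u_1\dots u_r$ in $W(\Sigma,\vec k)\cup W(\Sigma,\vec k;\upsilon)$, write $w<u$ iff $l<r$ and $u_1=\dots=u_l=\alpha_1$; in that case $w\star u=w_1\dots w_lu_{l+1}\dots u_r$ (iterated concatenations are taken left to right). $T_0(w)=w$; for $p\in\mathbb N$, $T_p(w)$ is the word of the same length obtained by replacing each $w_i=\upsilon$ by $\alpha_p$ if $k_i\ge p$ and by $\alpha_{k_i}$ if $k_i<p$, leaving letters of $\Sigma$ unchanged. $W^\infty(\Sigma,\vec k;\upsilon)$ is the set of sequences $(w_n)_{n\in\mathbb N}$ in $W(\Sigma,\vec k;\upsilon)$ with $w_n<w_{n+1}$ for all $n$. -}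

module Defs where

open import Data.Nat using (ℕ; zero; suc; _≤_; _<_; _≤ᵇ_)
open import Data.Bool using (if_then_else_)
open import Data.Fin using (Fin; toℕ)
open import Data.List using (List; []; _∷_; length; lookup; _++_; drop; foldl)
open import Data.Product using (Σ; _×_; _,_; proj₁; proj₂)
open import Data.Empty using (⊥)
open import Data.Unit using (⊤)
open import Relation.Binary.PropositionalEquality using (_≡_)

-- Conventions (0-indexed shift): the paper's sequence (k_n)_{n≥1} is given
-- as k : ℕ → ℕ with  k i = k_{i+1}.  Word positions are 0-indexed, so the
-- letter at (list) position i is constrained by k i (= k_{i+1} in the paper).
-- Likewise a sequence (u_n)_{n≥1} is u : ℕ → Word with u n = u_{n+1}.

-- Letters: the variable υ, and α m standing for the paper's α_m (m ≥ 1).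
data Letter : Set where
  υ : Letter
  α : ℕ → Letter

Word : Set
Word = List Letter

ΣLetter : ℕ → Letter → Set
ΣLetter K υ     = ⊥
ΣLetter K (α m) = 1 ≤ m × m ≤ K

VLetter : ℕ → Letter → Set
VLetter K υ     = ⊤
VLetter K (α m) = 1 ≤ m × m ≤ K

InW : (ℕ → ℕ) → Word → Set
InW k w = (1 ≤ length w) × ((i : Fin (length w)) → ΣLetter (k (toℕ i)) (lookup w i))

InWv : (ℕ → ℕ) → Word → Set
InWv k w = ((i : Fin (length w)) → VLetter (k (toℕ i)) (lookup w i))
         × Σ (Fin (length w)) (λ i → lookup w i ≡ υ)

_≺_ : Word → Word → Set
w ≺ u = (length w < length u)
      × ((j : Fin (length u)) → toℕ j < length w → lookup u j ≡ α 1)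

_⋆_ : Word → Word → Word
w ⋆ u = w ++ drop (length w) u

Tgo : (ℕ → ℕ) → ℕ → ℕ → Word → Word
Tgo k p i []          = []
Tgo k p i (υ ∷ w)     = (if p ≤ᵇ k i then α p else α (k i)) ∷ Tgo k p (suc i) w
Tgo k p i (α m ∷ w)   = α m ∷ Tgo k p (suc i) w

T : (ℕ → ℕ) → ℕ → Word → Word
T k zero    w = w
T k (suc p) w = Tgo k (suc p) 0 w

InW∞ : (ℕ → ℕ) → (ℕ → Word) → Set
InW∞ k u = ((n : ℕ) → InWv k (u n)) × ((n : ℕ) → u n ≺ u (suc n))

combine : (ℕ → ℕ) → (ℕ → Word) → List (ℕ × ℕ) → Word
combine k u []             = []
combine k u ((n , p) ∷ np) =
  foldl (λ acc q → acc ⋆ T k (proj₂ q) (u (proj₁ q))) (T k p (u n)) np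

{-# OPTIONS --safe #-}
module Submission where

-- The classical proof finds an idempotent ultrafilter c on constant words and an idempotent v on
-- variable words with T_p v = c for p ≥ 1 and v c = c v = v.  Here Zorn's lemma is avoided: a block
-- sequence X stands for the filter generated by the spans of its tails, and "A is large" means
-- that A meets the span of every refinement of X, as in Baumgartner's proof of Hindman's theorem.
-- A large set is syndetic, and countably many colours can be decided along a refinement, so that
-- limits along an ultrafilter become colourings g(t) = lim_z χ(t z).
-- For constant words, the lines needed in the induction come from the Hales–Jewett property for
-- m letters, and the partition theorem for m letters gives that property for m + 1 letters.
-- For variable words, χ is first replaced by its limit η under right multiplication by constant
-- words; the colour of a product is then governed by g(t) = lim η(t z) over variable z, and the
-- theorem for constant words makes t ↦ g(t w) constant in the constant word w (the relation c v = v).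

open import Defs
open import Axiom.ExcludedMiddle using (ExcludedMiddle)
open import Data.Bool using (Bool; true; false; _∧_; _∨_; if_then_else_)
open import Data.Bool.Properties using (_≟_; ∨-assoc; ∧-distribˡ-∨; ∧-identityʳ; ∨-identityʳ; ∨-zeroʳ; T-≡)
open import Data.Fin using (Fin; zero; suc; toℕ)
open import Data.Fin.Properties using (pigeonhole)
open import Data.List using (List; []; _∷_; length; lookup; _++_; map; upTo; filter; foldl; replicate; cartesianProductWith)
open import Data.List.Membership.Propositional using (_∈_)
open import Data.List.Membership.Propositional.Properties
open import Data.List.Properties using (++-identityʳ; drop-[]; length-++; length-replicate)
open import Data.List.Relation.Unary.All as All using (All; []; _∷_)
open import Data.List.Relation.Unary.Any as Any using (Any; here; there)
open import Data.List.Relation.Unary.Any.Properties using (lookup-index)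
open import Data.List.Relation.Unary.Linked using (Linked; _∷_)
open import Data.Nat.Binary as Bin using (ℕᵇ)
open import Data.Nat.Binary.Properties using (fromℕ-toℕ)
open import Data.Nat hiding (_≟_)
open import Data.Nat.Properties hiding (_≟_)
open import Data.Product using (Σ; _×_; _,_; proj₁; proj₂)
open import Data.Sum using (inj₁; inj₂)
open import Data.Unit using (⊤; tt)
open import Function using (Equivalence)
open import Level using (Level; 0ℓ) renaming (suc to lsuc; _⊔_ to _⊔ℓ_)
open import Relation.Binary.PropositionalEquality
open import Relation.Nullary using (¬_; Dec; yes; no; contradiction)

-- Substitution monoids and bounds on letters

isVar : ℕ → Bool
isVar zero    = true
isVar (suc _) = false

-- The substitution τ_q after τ_p is τ_{q ▷ p}, since τ_p leaves no variable when p ≥ 1.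
_▷_ : ℕ → ℕ → ℕ
q ▷ zero  = q
q ▷ suc p = suc p

isVar-▷ : ∀ q p → isVar (q ▷ p) ≡ isVar q ∧ isVar p
isVar-▷ q       zero    = sym (∧-identityʳ (isVar q))
isVar-▷ zero    (suc p) = refl
isVar-▷ (suc q) (suc p) = refl

▷-≤ : ∀ {q p m} → q ≤ m → p ≤ m → q ▷ p ≤ m
▷-≤ {p = zero}  q≤m _   = q≤m
▷-≤ {p = suc p} _   p≤m = p≤m

-- Countability enters through `enum` and `index`: a fusion can then settle the elements of the
-- monoid one at a time.
record SubstitutionMonoid : Set₁ where
  infixl 7 _·_
  field
    Carrier   : Set
    _·_       : Carrier → Carrier → Carrier
    ε         : Carrier
    τ         : ℕ → Carrier → Carrier
    assoc     : ∀ x y z → (x · y) · z ≡ x · (y · z)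
    identityˡ : ∀ x → ε · x ≡ x
    τ-zero    : ∀ x → τ 0 x ≡ x
    τ-ε       : ∀ p → τ p ε ≡ ε
    τ-·       : ∀ p x y → τ p (x · y) ≡ τ p x · τ p y
    τ-▷       : ∀ q p x → τ q (τ p x) ≡ τ (q ▷ p) x
    enum      : ℕ → Carrier
    index     : Carrier → ℕ
    enum-index : ∀ x → enum (index x) ≡ x

record Bound : Set where
  field
    at   : ℕ → ℕ
    mono : ∀ n → at n ≤ at (suc n)
    pos  : ∀ n → 1 ≤ at n

open Bound

mono-≤′ : ∀ κ {m n} → m ≤′ n → at κ m ≤ at κ n
mono-≤′ κ ≤′-refl             = ≤-refl
mono-≤′ κ (≤′-step {n} m≤′n) = ≤-trans (mono-≤′ κ m≤′n) (mono κ n)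

mono-≤ : ∀ κ {m n} → m ≤ n → at κ m ≤ at κ n
mono-≤ κ m≤n = mono-≤′ κ (≤⇒≤′ m≤n)

_≼_ : Bound → Bound → Set
κ ≼ κ′ = ∀ n → at κ n ≤ at κ′ n

≼-refl : ∀ κ → κ ≼ κ
≼-refl κ n = ≤-refl

module Ramsey (S : SubstitutionMonoid) (em : ExcludedMiddle 0ℓ) where

  open SubstitutionMonoid S renaming (Carrier to M)

  -- Spans of sequences: substitution and concatenation

  Seq : Set
  Seq = ℕ → M

  -- Span κ X l b w : w = τ_{p₁}(X n₁) ⋯ τ_{pᵣ}(X nᵣ) with l ≤ n₁ < ⋯ < nᵣ and pᵢ ≤ κ nᵢ,
  -- where b records whether some pᵢ is 0.
  data Span (κ : Bound) (X : Seq) : ℕ → Bool → M → Set where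
    last : ∀ {l} p → p ≤ at κ l → Span κ X l (isVar p) (τ p (X l))
    skip : ∀ {l b w} → Span κ X (suc l) b w → Span κ X l b w
    cons : ∀ {l b w} p → p ≤ at κ l → Span κ X (suc l) b w →
           Span κ X l (isVar p ∨ b) (τ p (X l) · w)

  down′ : ∀ {κ X l l′ b w} → l ≤′ l′ → Span κ X l′ b w → Span κ X l b w
  down′ ≤′-refl       s = s
  down′ (≤′-step l≤) s = down′ l≤ (skip s)

  down : ∀ {κ X l l′ b w} → l ≤ l′ → Span κ X l′ b w → Span κ X l b w
  down l≤ = down′ (≤⇒≤′ l≤)

  relax : ∀ {κ κ′ X l b w} → (∀ n → l ≤ n → at κ n ≤ at κ′ n) → Span κ X l b w → Span κ′ X l b w
  relax κ≤ (last p p≤)   = last p (≤-trans p≤ (κ≤ _ ≤-refl))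
  relax κ≤ (skip s)      = skip (relax (λ n l<n → κ≤ n (<⇒≤ l<n)) s)
  relax κ≤ (cons p p≤ s) =
    cons p (≤-trans p≤ (κ≤ _ ≤-refl)) (relax (λ n l<n → κ≤ n (<⇒≤ l<n)) s)

  relax≼ : ∀ {κ κ′ X l b w} → κ ≼ κ′ → Span κ X l b w → Span κ′ X l b w
  relax≼ κ≼ = relax (λ n _ → κ≼ n)

  basic : ∀ κ X l → Span κ X l true (X l)
  basic κ X l = subst (Span κ X l true) (τ-zero (X l)) (last 0 z≤n)

  -- In each factor the two letters compose by `▷`; the bound at l suffices for all later factors
  -- because κ is nondecreasing.
  substitute : ∀ {κ X l b w} → Span κ X l b w → ∀ q → q ≤ at κ l → Span κ X l (isVar q ∧ b) (τ q w)
  substitute {κ} {X} {l} (last p p≤) q q≤ =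
    subst₂ (Span κ X l) (isVar-▷ q p) (sym (τ-▷ q p (X l))) (last (q ▷ p) (▷-≤ {q} {p} q≤ p≤))
  substitute {κ} (skip {l} s) q q≤ = skip (substitute s q (≤-trans q≤ (mono κ l)))
  substitute {κ} {X} (cons {l} {b} {w} p p≤ s) q q≤ =
    subst₂ (Span κ X l)
      (trans (cong (_∨ (isVar q ∧ b)) (isVar-▷ q p)) (sym (∧-distribˡ-∨ (isVar q) (isVar p) b)))
      (trans (cong (_· τ q w) (sym (τ-▷ q p (X l)))) (sym (τ-· q (τ p (X l)) w)))
      (cons (q ▷ p) (▷-≤ {q} {p} q≤ p≤) (substitute s q (≤-trans q≤ (mono κ l))))

  substitute-true : ∀ {κ X l w} → Span κ X l true w → ∀ q → q ≤ at κ l → Span κ X l (isVar q) (τ q w)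
  substitute-true {κ} {X} {l} {w} s q q≤ =
    subst (λ b → Span κ X l b (τ q w)) (∧-identityʳ (isVar q)) (substitute s q q≤)

  const-fixed : ∀ {κ X l b w} → Span κ X l b w → b ≡ false → ∀ q → τ q w ≡ w
  const-fixed {X = X} (last {l} (suc p) _) _ q = τ-▷ q (suc p) (X l)
  const-fixed (skip s) b≡ q = const-fixed s b≡ q
  const-fixed {X = X} (cons {l} {w = w} (suc p) _ s) b≡ q =
    trans (τ-· q (τ (suc p) (X l)) w) (cong₂ _·_ (τ-▷ q (suc p) (X l)) (const-fixed s b≡ q))

  -- An index from which on every word of the span may be appended to τ_q w, uniformly in q.
  record Room (κ : Bound) (X : Seq) (l : ℕ) (b : Bool) (w : M) : Set where
    constructor room
    field
      next   : ℕ
      l<next : l < next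
      append : ∀ κ′ → κ ≼ κ′ → ∀ q → q ≤ at κ′ l → ∀ {c t} → Span κ′ X next c t →
               Span κ′ X l ((isVar q ∧ b) ∨ c) (τ q w · t)

  findRoom : ∀ {κ X l b w} → Span κ X l b w → Room κ X l b w
  findRoom {κ} {X} {l} (last p p≤) = room (suc l) ≤-refl λ κ′ κ≼ q q≤ {c} {t} s →
    subst₂ (Span κ′ X l) (cong (_∨ c) (isVar-▷ q p)) (cong (_· t) (sym (τ-▷ q p (X l))))
      (cons (q ▷ p) (▷-≤ {q} {p} q≤ (≤-trans p≤ (κ≼ l))) s)
  findRoom {κ} {X} {l} (skip s) with findRoom s
  ... | room l′ l<l′ f = room l′ (<-trans (n<1+n l) l<l′) λ κ′ κ≼ q q≤ t →
    skip (f κ′ κ≼ q (≤-trans q≤ (mono κ′ l)) t)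
  findRoom {κ} {X} (cons {l} {b} {w} p p≤ s) with findRoom s
  ... | room l′ l<l′ f = room l′ (<-trans (n<1+n l) l<l′) λ κ′ κ≼ q q≤ {c} {t} u →
    subst₂ (Span κ′ X l)
      (begin
        isVar (q ▷ p) ∨ ((isVar q ∧ b) ∨ c)          ≡⟨ cong (_∨ ((isVar q ∧ b) ∨ c)) (isVar-▷ q p) ⟩
        (isVar q ∧ isVar p) ∨ ((isVar q ∧ b) ∨ c)    ≡⟨ ∨-assoc (isVar q ∧ isVar p) _ c ⟨
        ((isVar q ∧ isVar p) ∨ (isVar q ∧ b)) ∨ c    ≡⟨ cong (_∨ c) (∧-distribˡ-∨ (isVar q) (isVar p) b) ⟨
        (isVar q ∧ (isVar p ∨ b)) ∨ c                ∎)
      (begin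
        τ (q ▷ p) (X l) · (τ q w · t)   ≡⟨ assoc _ _ _ ⟨
        (τ (q ▷ p) (X l) · τ q w) · t   ≡⟨ cong (λ x → (x · τ q w) · t) (τ-▷ q p (X l)) ⟨
        (τ q (τ p (X l)) · τ q w) · t   ≡⟨ cong (_· t) (τ-· q _ w) ⟨
        τ q (τ p (X l) · w) · t         ∎)
      (cons (q ▷ p) (▷-≤ {q} {p} q≤ (≤-trans p≤ (κ≼ l))) (f κ′ κ≼ q (≤-trans q≤ (mono κ′ l)) u))
    where open ≡-Reasoning

  -- Refinements and tails

  -- The bound κ′ is universally quantified so that letters beyond κ may still be substituted
  -- after passing to a refinement; the induction step for the Hales–Jewett property needs this.
  record Refines (κ : Bound) (Y X : Seq) : Set where
    constructor refining
    field
      shrink : ∀ l → Σ ℕ λ l′ → ∀ κ′ → κ ≼ κ′ → ∀ {b w} → Span κ′ Y l′ b w → Span κ′ X l b w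

  open Refines

  refines-refl : ∀ {κ X} → Refines κ X X
  refines-refl .shrink l = l , λ _ _ s → s

  refines-trans : ∀ {κ X Y Z} → Refines κ Z Y → Refines κ Y X → Refines κ Z X
  refines-trans Z⊑Y Y⊑X .shrink l with shrink Y⊑X l
  ... | m , f with shrink Z⊑Y m
  ... | n , g = n , λ κ′ κ≼ s → f κ′ κ≼ (g κ′ κ≼ s)

  tail : Seq → ℕ → Seq
  tail X l n = X (n + l)

  tail-span : ∀ {κ} X l {n b w} → Span κ (tail X l) n b w → Span κ X (n + l) b w
  tail-span {κ} X l (last {n} p p≤)   = last p (≤-trans p≤ (mono-≤ κ (m≤m+n n l)))
  tail-span {κ} X l (skip s)          = skip (tail-span X l s)
  tail-span {κ} X l (cons {n} p p≤ s) = cons p (≤-trans p≤ (mono-≤ κ (m≤m+n n l))) (tail-span X l s)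

  tail-refines : ∀ {κ} X l → Refines κ (tail X l) X
  tail-refines X l .shrink n = n , λ κ′ _ s → down (m≤m+n n l) (tail-span X l s)

  refine-into : ∀ {κ X Y} → Refines κ Y X → ∀ l →
                Σ Seq λ Z → Refines κ Z Y × (∀ {b w} → Span κ Z 0 b w → Span κ Y 0 b w) ×
                (∀ {b w} → Span κ Z 0 b w → Span κ X l b w)
  refine-into {κ} {X} {Y} Y⊑X l with shrink Y⊑X l
  ... | l′ , f = tail Y l′ , tail-refines {κ} Y l′ ,
    (λ s → down z≤n (tail-span Y l′ s)) , λ s → f κ (≼-refl κ) (tail-span Y l′ s)

  -- Fusion of a descending sequence of conditions

  -- A diagonal sequence Y takes the place of a lower bound of the conditions `cond (st n)`. The
  -- relation R records what the n-th choice has secured, and `idx` how far out in its condition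
  -- that choice must lie.
  record Fused (κ : Bound) {ℓ : Level} {St : Set ℓ} (cond : St → Seq) (idx : St → ℕ)
               (R : ℕ → St → M → St → Set) (s₀ : St) : Set ℓ where
    field
      Y       : Seq
      st      : ℕ → St
      start   : st 0 ≡ s₀
      related : ∀ n → R n (st n) (Y n) (st (suc n))
      inside  : ∀ κ′ → κ ≼ κ′ → ∀ {n b w} → Span κ′ Y n b w → Span κ′ (cond (st n)) (idx (st n)) b w
      refines : ∀ n → Refines κ Y (cond (st n))

  module Fusion
    (κ : Bound) {ℓ : Level} {St : Set ℓ} (cond : St → Seq) (idx : St → ℕ) (R : ℕ → St → M → St → Set)
    (step : ∀ n s l → n ≤ l → idx s ≤ l →
            Σ M λ y → Span κ (cond s) l true y ×
            Σ St λ s′ → Refines κ (cond s′) (cond s) × R n s y s′)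
    (s₀ : St) where

    -- `Past` accumulates membership in the spans of all earlier conditions, so that refinement of
    -- each of them can be read off at the end. The next term is taken from index `front` on.
    record Stage (n : ℕ) : Set (ℓ ⊔ℓ lsuc 0ℓ) where
      field
        state  : St
        Past   : Bound → ℕ → Bool → M → Set
        reach  : ∀ m → Σ ℕ λ l → ∀ κ′ → κ ≼ κ′ → ∀ {b w} → Span κ′ (cond state) l b w → Past κ′ m b w
        front   : ℕ
        n≤front : n ≤ front
        idx≤   : idx state ≤ front
    open Stage

    Pick : ∀ {n} → Stage n → Set ℓ
    Pick {n} G = Σ M λ y → Span κ (cond (state G)) (front G) true y ×
                 Σ St λ s′ → Refines κ (cond s′) (cond (state G)) × R n (state G) y s′

    pick : ∀ {n} (G : Stage n) → Pick G
    pick {n} G = step n (state G) (front G) (n≤front G) (idx≤ G)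

    Past⁺ : ∀ {n} → Stage n → Bound → ℕ → Bool → M → Set
    Past⁺ G κ′ m b w = Past G κ′ m b w × Span κ′ (cond (state G)) m b w

    reach⁺ : ∀ {n} (G : Stage n) (P : Pick G) m → Σ ℕ λ l → ∀ κ′ → κ ≼ κ′ → ∀ {b w} →
             Span κ′ (cond (proj₁ (proj₂ (proj₂ P)))) l b w → Past⁺ G κ′ m b w
    reach⁺ G (_ , _ , s′ , ref , _) m with reach G m
    ... | a , f with shrink ref (a ⊔ m)
    ... | c , g = c , λ κ′ κ≼ s →
      f κ′ κ≼ (down (m≤m⊔n a m) (g κ′ κ≼ s)) , down (m≤n⊔m a m) (g κ′ κ≼ s)

    afterRoom : ∀ {n} (G : Stage n) (P : Pick G) → Σ ℕ λ l → ∀ κ′ → κ ≼ κ′ → ∀ {b w} →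
                Span κ′ (cond (proj₁ (proj₂ (proj₂ P)))) l b w →
                Span κ′ (cond (state G)) (Room.next (findRoom (proj₁ (proj₂ P)))) b w
    afterRoom G (_ , y∈ , s′ , ref , _) = shrink ref (Room.next (findRoom y∈))

    next : ∀ {n} → Stage n → Stage (suc n)
    next {n} G = record
      { state  = s′
      ; Past   = Past⁺ G
      ; reach  = reach⁺ G (pick G)
      -- Beyond `a`, words lie in the span of every condition so far from suc n on; beyond `c`, they
      -- may be appended to the term just picked.
      ; front   = suc n ⊔ (idx s′ ⊔ (a ⊔ c))
      ; n≤front = m≤m⊔n (suc n) (idx s′ ⊔ (a ⊔ c))
      ; idx≤   = m≤n⇒m≤o⊔n (suc n) (m≤m⊔n (idx s′) _)
      }
      where
      s′ = proj₁ (proj₂ (proj₂ (pick G)))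
      a  = proj₁ (reach⁺ G (pick G) (suc n))
      c  = proj₁ (afterRoom G (pick G))

    stage : ∀ n → Stage n
    stage zero = record
      { state = s₀ ; Past = λ _ _ _ _ → ⊤ ; reach = λ m → 0 , λ _ _ _ → tt
      ; front = idx s₀ ; n≤front = z≤n ; idx≤ = ≤-refl }
    stage (suc n) = next (stage n)

    st : ℕ → St
    st n = state (stage n)

    Y : Seq
    Y n = proj₁ (pick (stage n))

    related : ∀ n → R n (st n) (Y n) (st (suc n))
    related n = proj₂ (proj₂ (proj₂ (proj₂ (pick (stage n)))))

    chosen : ∀ n → Span κ (cond (st n)) (front (stage n)) true (Y n)
    chosen n = proj₁ (proj₂ (pick (stage n)))

    shrinkRoom : ∀ n κ′ → κ ≼ κ′ → ∀ {b w} → Span κ′ (cond (st (suc n))) (front (stage (suc n))) b w →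
                 Span κ′ (cond (st n)) (Room.next (findRoom (chosen n))) b w
    shrinkRoom n κ′ κ≼ s = proj₂ (afterRoom G (pick G)) κ′ κ≼
      (down (m≤n⇒m≤o⊔n (suc n) (m≤n⇒m≤o⊔n (idx (st (suc n)))
        (m≤n⊔m (proj₁ (reach⁺ G (pick G) (suc n))) _))) s)
      where G = stage n

    -- What follows Y n lies in the next condition beyond its `front`, hence can be appended to Y n
    -- in the present one. As n ≤ `front`, letters admissible at n may be substituted in Y n.
    inside′ : ∀ κ′ → κ ≼ κ′ → ∀ {n b w} → Span κ′ Y n b w → Span κ′ (cond (st n)) (front (stage n)) b w
    inside′ κ′ κ≼ (last {n} q q≤) =
      substitute-true (relax≼ κ≼ (chosen n)) q (≤-trans q≤ (mono-≤ κ′ (n≤front (stage n))))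
    inside′ κ′ κ≼ (skip {n} s) =
      down (<⇒≤ (Room.l<next (findRoom (chosen n)))) (shrinkRoom n κ′ κ≼ (inside′ κ′ κ≼ s))
    inside′ κ′ κ≼ (cons {n} {b} {w} q q≤ s) =
      subst (λ c → Span κ′ (cond (st n)) (front (stage n)) (c ∨ b) (τ q (Y n) · w))
        (∧-identityʳ (isVar q))
        (Room.append (findRoom (chosen n)) κ′ κ≼ q (≤-trans q≤ (mono-≤ κ′ (n≤front (stage n))))
          (shrinkRoom n κ′ κ≼ (inside′ κ′ κ≼ s)))

    inside : ∀ κ′ → κ ≼ κ′ → ∀ {n b w} → Span κ′ Y n b w → Span κ′ (cond (st n)) (idx (st n)) b w
    inside κ′ κ≼ {n} s = down (idx≤ (stage n)) (inside′ κ′ κ≼ s)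

    past : ∀ i {N κ′ m b w} → i <′ N → Past (stage N) κ′ m b w → Span κ′ (cond (st i)) m b w
    past i ≤′-refl       (_ , s) = s
    past i (≤′-step i<) (p , _) = past i i< p

    refines : ∀ n → Refines κ Y (cond (st n))
    -- With N = i ⊔ m, the `Past` after stage N contains condition i, and its index suc N exceeds m.
    refines i .shrink m = suc N , λ κ′ κ≼ s → down (m≤n⇒m≤1+n (m≤n⊔m i m)) (past i (s≤′s (≤⇒≤′ (m≤m⊔n i m)))
      (proj₂ (reach⁺ G (pick G) (suc N)) κ′ κ≼
        (down (m≤n⇒m≤o⊔n (suc N) (m≤n⇒m≤o⊔n (idx (st (suc N))) (m≤m⊔n _ _))) (inside′ κ′ κ≼ s))))
      where
      N = i ⊔ m
      G = stage N

    abstract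
      fused : Fused κ cond idx R s₀
      fused = record
        { Y = Y ; st = st ; start = refl ; related = related ; inside = inside ; refines = refines }

  -- Large sets and limits of colourings

  module Colouring (κ : Bound) where

    Sp : Seq → ℕ → Bool → M → Set
    Sp = Span κ

    _⊑_ : Seq → Seq → Set
    _⊑_ = Refines κ

    into : ∀ {X Y} → Y ⊑ X → ∀ l → Σ ℕ λ l′ → ∀ {b w} → Sp Y l′ b w → Sp X l b w
    into Y⊑X l with shrink Y⊑X l
    ... | l′ , f = l′ , f κ (≼-refl κ)

    inhabited : ∀ b X l → Σ M (Sp X l b)
    inhabited true  X l = X l , basic κ X l
    inhabited false X l = τ 1 (X l) , last 1 (pos κ l)

    Large : Bool → (M → Set) → Seq → Set
    Large b A X = ∀ Y → Y ⊑ X → Σ M λ w → Sp Y 0 b w × A w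

    large-far : ∀ {b A X Y} → Large b A X → Y ⊑ X → ∀ l → Σ M λ w → Sp Y l b w × A w
    large-far {Y = Y} lg Y⊑X l with lg (tail Y l) (refines-trans (tail-refines Y l) Y⊑X)
    ... | w , w∈ , Aw = w , tail-span Y l w∈ , Aw

    large-refine : ∀ {b A X Y} → Large b A X → Y ⊑ X → Large b A Y
    large-refine lg Y⊑X Z Z⊑Y = lg Z (refines-trans Z⊑Y Y⊑X)

    large-map : ∀ {b} {A B : M → Set} {X} → (∀ {w} → A w → B w) → Large b A X → Large b B X
    large-map f lg Y Y⊑X with lg Y Y⊑X
    ... | w , w∈ , Aw = w , w∈ , f Aw

    -- If the span of some refinement misses the first piece, then the remaining pieces are jointly
    -- large below that refinement, and induction on r applies.
    large-split : ∀ {b} r (P : Fin r → M → Set) (A : M → Set) X →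
                  Large b (λ z → A z × Σ (Fin r) λ i → P i z) X →
                  Σ Seq λ Y → Y ⊑ X × Σ (Fin r) λ i → Large b (λ z → A z × P i z) Y
    large-split zero P A X lg with lg X refines-refl
    ... | _ , _ , _ , () , _
    large-split {b} (suc r) P A X lg
      with em {Σ Seq λ Y → Y ⊑ X × ¬ Σ M λ w → Sp Y 0 b w × A w × P zero w}
    ... | no none = X , refines-refl , zero , λ Y Y⊑X → meets Y Y⊑X em
      where
      meets : ∀ Y → Y ⊑ X → Dec (Σ M λ w → Sp Y 0 b w × A w × P zero w) → _
      meets Y Y⊑X (yes p) = p
      meets Y Y⊑X (no ¬p) = contradiction (Y , Y⊑X , ¬p) none
    ... | yes (Y , Y⊑X , avoids) with large-split r (λ i → P (suc i)) A Y large′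
      where
      large′ : Large b (λ z → A z × Σ (Fin r) λ i → P (suc i) z) Y
      large′ Z Z⊑Y with into Z⊑Y 0
      ... | l , f with large-far lg (refines-trans Z⊑Y Y⊑X) l
      ...   | w , w∈ , Aw , zero  , p = contradiction (w , f w∈ , Aw , p) avoids
      ...   | w , w∈ , Aw , suc i , p = w , down z≤n w∈ , Aw , i , p
    ... | Z , Z⊑Y , i , lg′ = Z , refines-trans Z⊑Y Y⊑X , suc i , lg′

    -- g t plays the role of the limit of χ (t · z) as z runs through an ultrafilter.
    Decides : ∀ {r} → Bool → (M → Fin r) → (M → Fin r) → Seq → Set
    Decides b χ g X = ∀ L → Large b (λ z → All (λ t → χ (t · z) ≡ g t) L) X

    -- `large-split` fixes the limit at `enum n` in the n-th step of a fusion, while the large set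
    -- shrinks. For a finite list L, the large set of one late stage agrees with all the limits at
    -- once.
    decide : ∀ {r} b (χ : M → Fin r) X → Σ Seq λ Y → Y ⊑ X × Σ (M → Fin r) λ g → Decides b χ g Y
    decide {r} b χ X = F.Y , subst (λ s → F.Y ⊑ proj₁ (proj₂ s)) F.start (F.refines 0) , limit , λ L → large-map (agree L) (large-refine
        (proj₂ (proj₂ (F.st (proj₁ (late L))))) (F.refines (proj₁ (late L))))
      where
      St : Set₁
      St = Σ (M → Set) λ A → Σ Seq λ X → Large b A X

      Step : ℕ → St → M → St → Set
      Step n s y s′ = Σ (Fin r) λ i → ∀ {z} → proj₁ s′ z → proj₁ s z × χ (enum n · z) ≡ i

      step : ∀ n (s : St) l → n ≤ l → 0 ≤ l → Σ M λ y → Sp (proj₁ (proj₂ s)) l true y ×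
             Σ St λ s′ → proj₁ (proj₂ s′) ⊑ proj₁ (proj₂ s) × Step n s y s′
      step n (A , X , lg) l _ _ with large-split r (λ i z → χ (enum n · z) ≡ i) A X
                                       (large-map (λ a → a , _ , refl) lg)
      ... | Y , Y⊑X , i , lg′ = X l , basic κ X l , (_ , Y , lg′) , Y⊑X , i , λ a → a

      start : St
      start = (λ _ → ⊤) , X , λ Y _ → proj₁ (inhabited b Y 0) , proj₂ (inhabited b Y 0) , tt

      abstract
        sequence : Fused κ (λ s → proj₁ (proj₂ s)) (λ _ → 0) Step start
        sequence = Fusion.fused κ (λ s → proj₁ (proj₂ s)) (λ _ → 0) Step step start

      module F = Fused sequence

      limit : M → Fin r
      limit t = proj₁ (F.related (index t))

      A : ℕ → M → Set
      A n = proj₁ (F.st n)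

      A-anti : ∀ {m n z} → m ≤′ n → A n z → A m z
      A-anti ≤′-refl a             = a
      A-anti (≤′-step {n} m≤n) a = A-anti m≤n (proj₁ (proj₂ (F.related n) a))

      late : ∀ L → Σ ℕ λ N → ∀ {z} → A N z → All (λ t → χ (t · z) ≡ limit t) L
      late []      = 0 , λ _ → []
      late (t ∷ L) with late L
      ... | N , f = suc (index t) ⊔ N , λ {z} a →
        subst (λ s → χ (s · z) ≡ limit t) (enum-index t)
          (proj₂ (proj₂ (F.related (index t)) (A-anti (≤⇒≤′ (m≤m⊔n (suc (index t)) N)) a)))
        ∷ f (A-anti (≤⇒≤′ (m≤n⊔m (suc (index t)) N)) a)

      agree : ∀ L {z} → A (proj₁ (late L)) z → All (λ t → χ (t · z) ≡ limit t) L
      agree L = proj₂ (late L)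

    -- Finite lists of prefixes and syndetic sets

    -- Letters p with p ≥ 1 may always precede the last letter; the letter 0 only if b = true.
    Precedes : Bool → ℕ → Set
    Precedes b p = isVar p ∨ b ≡ b

    letters : Bool → ℕ → List ℕ
    letters b m = filter (λ p → isVar p ∨ b ≟ b) (upTo (suc m))

    letters⁺ : ∀ b {m p} → p ≤ m → Precedes b p → p ∈ letters b m
    letters⁺ b p≤ ok = ∈-filter⁺ (λ p → isVar p ∨ b ≟ b) (∈-upTo⁺ (s≤s p≤)) ok

    letters⁻ : ∀ b {m p} → p ∈ letters b m → p ≤ m × Precedes b p
    letters⁻ b p∈ with ∈-filter⁻ (λ p → isVar p ∨ b ≟ b) p∈
    ... | p∈ , ok = s≤s⁻¹ (∈-upTo⁻ p∈) , ok

    extend : Bool → ℕ → M → List M → List M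
    extend b m y W = W ++ cartesianProductWith (λ t p → t · τ p y) W (letters b m)

    extend-old : ∀ b m y W {t} → t ∈ W → t ∈ extend b m y W
    extend-old b m y W = ∈-++⁺ˡ

    extend-new : ∀ b m y W {t p} → t ∈ W → p ≤ m → Precedes b p → t · τ p y ∈ extend b m y W
    extend-new b m y W t∈ p≤ ok =
      ∈-++⁺ʳ W (∈-cartesianProductWith⁺ (λ t p → t · τ p y) t∈ (letters⁺ b p≤ ok))

    extend-elim : ∀ b m y W (Q : M → Set) → (∀ {t} → t ∈ W → Q t) →
                  (∀ {t p} → t ∈ W → p ≤ m → Precedes b p → Q (t · τ p y)) →
                  ∀ {t} → t ∈ extend b m y W → Q t
    extend-elim b m y W Q old new t∈ with ∈-++⁻ W t∈
    ... | inj₁ t∈W = old t∈W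
    ... | inj₂ t∈′ with ∈-cartesianProductWith⁻ (λ t p → t · τ p y) W (letters b m) t∈′
    ...   | t , p , t∈W , p∈ , refl with letters⁻ b p∈
    ...     | p≤ , ok = new t∈W p≤ ok

    uniformly : (Q : M → ℕ → Set) → (∀ {t m n} → m ≤ n → Q t m → Q t n) → ∀ W →
                (∀ {t} → t ∈ W → Σ ℕ (Q t)) → Σ ℕ λ l → ∀ {t} → t ∈ W → Q t l
    uniformly Q up []      q = 0 , λ ()
    uniformly Q up (t ∷ W) q with q (here refl) | uniformly Q up W (λ s∈ → q (there s∈))
    ... | m , Qm | n , Qn = m ⊔ n , λ
      { (here refl) → up (m≤m⊔n m n) Qm ; (there s∈) → up (m≤n⊔m m n) (Qn s∈) }

    -- Vacuous for b = false.
    Absorbs : Bool → (M → Set) → Seq → Set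
    Absorbs b B X = ∀ t → Σ ℕ λ l → b ≡ true → ∀ {z} → Sp X l false z → B (t · z) → B t

    -- One of the finitely many left quotients of B by words of W contains an instance of y. For b =
    -- true the only instance considered is y itself, up to `τ-zero`.
    Hit : Bool → (M → Set) → ℕ → List M → M → Set
    Hit b B m W y = Σ ℕ λ p → isVar p ≡ b × p ≤ m × Σ M λ w → w ∈ W × B (w · τ p y)

    -- For b = true a prefix may or may not contain the variable, so the product has a known flag
    -- only if a variable word follows; this is the condition `b ∨ c ≡ c`.
    record Prefixes (b : Bool) (X : Seq) (l₀ : ℕ) : Set where
      field
        from   : ℕ
        l₀≤    : l₀ ≤ from
        words  : List M
        append : ∀ {w} → w ∈ words → ∀ {c t} → b ∨ c ≡ c → Sp X from c t → Sp X l₀ c (w · t)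
        fixed  : b ≡ false → ∀ {w} → w ∈ words → ∀ q → τ q w ≡ w

    open Prefixes

    raise : ∀ {b X l₀} (s : Prefixes b X l₀) l → from s ≤ l → Prefixes b X l₀
    raise s l ≤l = record
      { from = l ; l₀≤ = ≤-trans (l₀≤ s) ≤l ; words = words s
      ; append = λ w∈ ok t∈ → append s w∈ ok (down ≤l t∈) ; fixed = fixed s }

    private
      flags : ∀ a b c → a ∨ b ≡ b → b ∨ c ≡ c → (a ∧ true) ∨ c ≡ c
      flags true  true c     _ refl = refl
      flags false b    c     _ _    = refl

      onlyLast : ∀ p c b → isVar p ∨ c ≡ b → ¬ c ≡ b → b ≡ true × c ≡ false × p ≡ 0
      onlyLast zero    true  .true refl c≢ = contradiction refl c≢
      onlyLast zero    false .true refl c≢ = refl , refl , refl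
      onlyLast (suc p) c     .c    refl c≢ = contradiction refl c≢

    adjoin : ∀ {b X l₀} (s : Prefixes b X l₀) {y} → Sp X (from s) true y → ℕ → Prefixes b X l₀
    adjoin {b} {X} {l₀} s {y} y∈ m = record
      { from   = next ⊔ m
      ; l₀≤    = ≤-trans (l₀≤ s) (≤-trans (<⇒≤ l<next) (m≤m⊔n next m))
      ; words  = extend b (at κ (from s)) y (words s)
      ; append = extend-elim b _ y (words s)
          (λ w → ∀ {c t} → b ∨ c ≡ c → Sp X (next ⊔ m) c t → Sp X l₀ c (w · t))
          (λ w∈ ok t∈ → append s w∈ ok (down (<⇒≤ l<next) (down (m≤m⊔n next m) t∈)))
          (λ {w} {p} w∈ p≤ pre {c} {t} ok t∈ → subst (Sp X l₀ c) (sym (assoc w (τ p y) t))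
            (append s w∈ ok (subst (λ a → Sp X (from s) a (τ p y · t)) (flags (isVar p) b c pre ok)
              (after κ (≼-refl κ) p p≤ (down (m≤m⊔n next m) t∈)))))
      ; fixed  = λ b≡ → extend-elim b _ y (words s) (λ w → ∀ q → τ q w ≡ w) (fixed s b≡) λ w∈ p≤ pre q → new b≡ pre w∈ q
      }
      where
      open Room (findRoom y∈) renaming (append to after)

      new : ∀ {w p} → b ≡ false → Precedes b p → w ∈ words s → ∀ q → τ q (w · τ p y) ≡ w · τ p y
      new {w} {suc p} refl pre w∈ q =
        trans (τ-· q w _) (cong₂ _·_ (fixed s refl w∈ q) (τ-▷ q (suc p) y))

    Syndetic : ∀ b → (M → Set) → (X : Seq) → ∀ {l₀} → Prefixes b X l₀ → Set
    Syndetic b B X s = ∀ {y} → Sp X (from s) true y → Hit b B (at κ (from s)) (words s) y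

    -- Each new term is not hit from any product of instances of earlier ones. For b = true the last
    -- variable factor may be followed by constant factors; `absorbs` removes these, and `drops`
    -- finds an index that works for all current prefixes.
    module Avoidance (b : Bool) (B : M → Set) (X : Seq) (absorbs : Absorbs b B X) (l₀ : ℕ)
                     (none : ¬ Σ (Prefixes b X l₀) (Syndetic b B X)) where

      avoided : (s : Prefixes b X l₀) →
                Σ M λ y → Sp X (from s) true y × ¬ Hit b B (at κ (from s)) (words s) y
      avoided s with em {Σ M λ y → Sp X (from s) true y × ¬ Hit b B (at κ (from s)) (words s) y}
      ... | yes p = p
      ... | no ¬p = contradiction (s , λ {y} y∈ → hits y∈ em) none
        where
        hits : ∀ {y} → Sp X (from s) true y → Dec (Hit b B (at κ (from s)) (words s) y) → _
        hits y∈ (yes h) = h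
        hits y∈ (no ¬h) = contradiction (_ , y∈ , ¬h) ¬p

      Drops : M → M → ℕ → Set
      Drops y t l = b ≡ true → ∀ {z} → Sp X l false z → B ((t · τ 0 y) · z) → B (t · τ 0 y)

      drops : ∀ y W → Σ ℕ λ l → ∀ {t} → t ∈ W → Drops y t l
      drops y W = uniformly (Drops y) (λ m≤n d b≡ z∈ → d b≡ (down m≤n z∈)) W (λ _ → absorbs _)

      record Step (n : ℕ) (s : Prefixes b X l₀) (y : M) (s′ : Prefixes b X l₀) : Set where
        field
          limit : ℕ
          n≤    : n ≤ limit
          old   : ∀ {t} → t ∈ words s → t ∈ words s′
          new   : ∀ {t p} → t ∈ words s → p ≤ at κ limit → Precedes b p → t · τ p y ∈ words s′
          miss  : ¬ Hit b B (at κ limit) (words s) y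
          drop  : ∀ {t} → t ∈ words s → Drops y t (from s′)

      start : Prefixes b X l₀
      start = record
        { from = l₀ ; l₀≤ = ≤-refl ; words = ε ∷ []
        ; append = λ { (here refl) {c} {t} _ t∈ → subst (Sp X l₀ c) (sym (identityˡ t)) t∈ }
        ; fixed = λ { _ (here refl) q → τ-ε q } }

      grow : ∀ {n} (s : Prefixes b X l₀) → n ≤ from s →
             (Σ M λ y → Sp X (from s) true y × ¬ Hit b B (at κ (from s)) (words s) y) →
             Σ M λ y → Sp X (from s) true y × Σ (Prefixes b X l₀) λ s′ → X ⊑ X × Step n s y s′
      grow s n≤ (y , y∈ , miss) = y , y∈ , adjoin s y∈ m , refines-refl , record
        { limit = from s ; n≤ = n≤
        ; old = extend-old b _ y (words s)
        ; new = extend-new b _ y (words s)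
        ; miss = miss
        ; drop = λ t∈ b≡ z∈ →
            proj₂ (drops y (words s)) t∈ b≡ (down (m≤n⊔m (Room.next (findRoom y∈)) m) z∈)
        }
        where m = proj₁ (drops y (words s))

      -- The Step from s is the one from raise s l, as only the field `from` differs.
      step : ∀ n (s : Prefixes b X l₀) l → n ≤ l → from s ≤ l → Σ M λ y → Sp X l true y ×
             Σ (Prefixes b X l₀) λ s′ → X ⊑ X × Step n s y s′
      step n s l n≤l ≤l =
        let y , y∈ , s′ , ref , st = grow (raise s l ≤l) n≤l (avoided (raise s l ≤l))
            open Step st
        in y , y∈ , s′ , ref , record
             { limit = limit ; n≤ = n≤ ; old = old ; new = new ; miss = miss ; drop = drop }

      abstract
        sequence : Fused κ (λ _ → X) from Step start
        sequence = Fusion.fused κ (λ _ → X) from Step step start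

      module F = Fused sequence

      avoids : ∀ {n a c t} → Sp F.Y n c a → c ≡ b → t ∈ words (F.st n) → ¬ B (t · a)
      avoids {n} (last p p≤) c≡ t∈ Bta =
        miss (p , c≡ , ≤-trans p≤ (mono-≤ κ n≤) , _ , t∈ , Bta)
        where open Step (F.related n)
      avoids {n} (skip a∈) c≡ t∈ = avoids a∈ c≡ (Step.old (F.related n) t∈)
      avoids {n} {t = t} (cons {b = c} {w = a} p p≤ a∈) c≡ t∈ Bta with c ≟ b
      ... | yes refl = avoids a∈ refl (Step.new (F.related n) t∈ (≤-trans p≤ (mono-≤ κ (Step.n≤ (F.related n)))) c≡)
                         (subst B (sym (assoc t _ a)) Bta)
      ... | no c≢b with onlyLast p c b c≡ c≢b
      ...   | b≡true , refl , refl = Step.miss (F.related n)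
        (0 , sym b≡true , z≤n , t , t∈ ,
          Step.drop (F.related n) t∈ b≡true (F.inside κ (≼-refl κ) a∈) (subst B (sym (assoc t _ a)) Bta))

      avoiding : Σ Seq λ Y → Y ⊑ X × (∀ {w} → Sp Y 0 b w → ¬ B w)
      avoiding = F.Y , F.refines 0 , λ w∈ Bw →
        avoids w∈ refl (subst (λ s → ε ∈ words s) (sym F.start) (here refl))
          (subst B (sym (identityˡ _)) Bw)

    -- Otherwise one could choose successively the terms of a refinement avoiding B.
    syndetic : ∀ b B X → Absorbs b B X → Large b B X → ∀ l₀ → Σ (Prefixes b X l₀) (Syndetic b B X)
    syndetic b B X absorbs lg l₀ with em {Σ (Prefixes b X l₀) (Syndetic b B X)}
    ... | yes p = p
    ... | no none with Avoidance.avoiding b B X absorbs l₀ none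
    ...   | Y , Y⊑X , avoids with lg Y Y⊑X
    ...     | w , w∈ , Bw = contradiction Bw (avoids w∈)

    -- Growing lists of prefixes and uniform witnesses

    record Grows (b : Bool) (n : ℕ) (P : List M) (y : M) (P′ : List M) : Set where
      field
        limit : ℕ
        n≤    : n ≤ limit
        old   : ∀ {t} → t ∈ P → t ∈ P′
        new   : ∀ {t p} → t ∈ P → p ≤ at κ limit → Precedes b p → t · τ p y ∈ P′

    extend-grows : ∀ b {n l} → n ≤ l → ∀ P y → Grows b n P y (extend b (at κ l) y P)
    extend-grows b {l = l} n≤l P y = record
      { limit = l ; n≤ = n≤l ; old = extend-old b _ y P ; new = extend-new b _ y P }

    private
      precedes-split : ∀ b p c → b ∨ (isVar p ∨ c) ≡ b → Precedes b p × b ∨ c ≡ b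
      precedes-split true  zero    c _  = refl , refl
      precedes-split true  (suc p) c _  = refl , refl
      precedes-split false (suc p) c eq = refl , eq

      precedes-last : ∀ b p → b ∨ isVar p ≡ b → Precedes b p
      precedes-last true  zero    _ = refl
      precedes-last true  (suc p) _ = refl
      precedes-last false (suc p) _ = refl

    -- Moving the factors of a into the prefix one by one leaves only the final factor outside, so a
    -- condition imposed when that term was chosen applies to the whole product.
    grows-span : ∀ {b} {P : ℕ → List M} {Y} (gr : ∀ n → Grows b n (P n) (Y n) (P (suc n))) →
                 ∀ {n c t a} → t ∈ P n → Sp Y n c a → b ∨ c ≡ b →
                 Σ ℕ λ N → Σ M λ s → Σ ℕ λ p → s ∈ P N × p ≤ at κ (Grows.limit (gr N)) ×
                 Precedes b p × t · a ≡ s · τ p (Y N)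
    grows-span {b} gr {n} t∈ (last p p≤) ok =
      n , _ , p , t∈ , ≤-trans p≤ (mono-≤ κ (Grows.n≤ (gr n))) , precedes-last b p ok , refl
    grows-span gr {n} t∈ (skip a∈) ok = grows-span gr (Grows.old (gr n) t∈) a∈ ok
    grows-span {b} gr {n} {t = t} t∈ (cons {b = c} {w = a} p p≤ a∈) ok
      with precedes-split b p c ok
    ... | pre , ok′
      with grows-span gr (Grows.new (gr n) t∈ (≤-trans p≤ (mono-≤ κ (Grows.n≤ (gr n)))) pre) a∈ ok′
    ... | N , s , q , s∈ , q≤ , pre′ , eq = N , s , q , s∈ , q≤ , pre′ , trans (sym (assoc t _ a)) eq

    grows-closed : ∀ {b} {P : ℕ → List M} {Y} (gr : ∀ n → Grows b n (P n) (Y n) (P (suc n))) →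
                   ∀ {n c t a} → t ∈ P n → Sp Y n c a → b ∨ c ≡ b → Σ ℕ λ N → t · a ∈ P N
    grows-closed {P = P} gr t∈ a∈ ok with grows-span gr t∈ a∈ ok
    ... | N , s , p , s∈ , p≤ , pre , eq =
      suc N , subst (_∈ P (suc N)) (sym eq) (Grows.new (gr N) s∈ p≤ pre)

    -- A finite colouring of u by a witness w with P w u, where `zero` means that there is none. On
    -- a monochromatic set of another colour the witness no longer depends on u.
    pick : (P : M → M → Set) (W : List M) → M → Fin (suc (length W))
    pick P W u with em {Any (λ w → P w u) W}
    ... | yes a = suc (Any.index a)
    ... | no  _ = zero

    pick-zero : ∀ P W u → pick P W u ≡ zero → ∀ {w} → w ∈ W → ¬ P w u
    pick-zero P W u eq w∈ Pwu with em {Any (λ w → P w u) W}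
    ... | no none = none (Any.map (λ { refl → Pwu }) w∈)

    pick-suc : ∀ P W u {j} → pick P W u ≡ suc j → P (lookup W j) u
    pick-suc P W u eq with em {Any (λ w → P w u) W}
    pick-suc P W u refl | yes a = lookup-index a

    common : ∀ (P : M → M → Set) W (I : M → Set) {c} → (∀ {u} → I u → pick P W u ≡ c) →
             ∀ {u w} → I u → w ∈ W → P w u → Σ M λ w → w ∈ W × ∀ {u} → I u → P w u
    common P W I {zero}  mono Iu w∈ Pwu = contradiction Pwu (pick-zero P W _ (mono Iu) w∈)
    common P W I {suc j} mono _  _  _   = lookup W j , ∈-lookup j , λ Iu → pick-suc P W _ (mono Iu)

    Positive : ℕ → ℕ → Set
    Positive m q = 1 ≤ q × q ≤ m

    positive : ∀ {m p} → isVar p ≡ false → p ≤ m → Positive m p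
    positive {p = suc p} _ p≤ = s≤s z≤n , p≤

    precedes-false : ∀ {p} → Precedes false p → isVar p ≡ false
    precedes-false {suc p} _ = refl

    -- The Hales-Jewett property inside the span of X beyond l, for the letters admissible at l.
    Lines : Set
    Lines = ∀ l X {r} (χ : M → Fin r) → Σ M λ y → Sp X l true y × Σ (Fin r) λ i →
            ∀ {q} → Positive (at κ l) q → χ (τ q y) ≡ i

    append₀ : ∀ {X l b y} (y∈ : Sp X l b y) {c t} → Sp X (Room.next (findRoom y∈)) c t →
              Sp X l (b ∨ c) (y · t)
    append₀ {X} {l} {b} {y} y∈ {c} {t} t∈ =
      subst (λ u → Sp X l (b ∨ c) (u · t)) (τ-zero y) (Room.append (findRoom y∈) κ (≼-refl κ) 0 z≤n t∈)

    append-τ : ∀ {X l y} (y∈ : Sp X l true y) {p c t} → p ≤ at κ l →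
               Sp X (Room.next (findRoom y∈)) c t → Sp X l (isVar p ∨ c) (τ p y · t)
    append-τ {X} {l} {y} y∈ {p} {c} {t} p≤ t∈ =
      subst (λ a → Sp X l (a ∨ c) (τ p y · t)) (∧-identityʳ (isVar p))
        (Room.append (findRoom y∈) κ (≼-refl κ) p p≤ t∈)

    -- The partition theorem for constant words, given lines

    module Constant (lines : Lines) where

      syndetic-false : ∀ {B X} → Large false B X → ∀ l₀ → Σ (Prefixes false X l₀) (Syndetic false B X)
      syndetic-false lg = syndetic false _ _ (λ t → 0 , λ ()) lg

      -- Colour u by a prefix w with w · u in B. On a monochromatic line y, syndeticity excludes the
      -- colour `zero`, so one prefix v serves all letters; being constant, v is unchanged by
      -- substitution, and v · y is the line.
      line : ∀ {B : M → Set} {X} → Large false B X → ∀ l →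
             Σ M λ y → Sp X l true y × (∀ {q} → Positive (at κ l) q → B (τ q y))
      line {B} {X} lg l with syndetic-false lg l
      ... | s , syn with lines (from s) X (pick (λ w u → B (w · u)) (words s))
      ... | y , y∈ , i , mono with syn y∈
      ... | p , p≡ , p≤ , w , w∈ , Bwy
        with common (λ w u → B (w · u)) (words s)
               (λ u → Σ ℕ λ q → Positive (at κ (from s)) q × u ≡ τ q y)
               (λ { (q , q∈ , refl) → mono q∈ }) (p , positive p≡ p≤ , refl) w∈ Bwy
      ... | v , v∈ , Bv = v · y , append s v∈ refl y∈ , λ {q} (1≤q , q≤) →
        subst B (sym (trans (τ-· q v y) (cong (_· τ q y) (fixed s refl v∈ q))))
          (Bv (q , (1≤q , ≤-trans q≤ (mono-≤ κ (l₀≤ s))) , refl))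

      module Limit {r} (χ g : M → Fin r) (X : Seq) (dec : Decides false χ g X) (i : Fin r) where

        large-χ : ∀ {Y} → Y ⊑ X → ∀ P → (∀ {t} → t ∈ P → g t ≡ i) →
                  Large false (λ z → ∀ {t} → t ∈ P → χ (t · z) ≡ i) Y
        large-χ Y⊑X P gP = large-refine
          (large-map {B = λ z → ∀ {t} → t ∈ P → χ (t · z) ≡ i} (λ ag t∈ → trans (All.lookup ag t∈) (gP t∈)) (dec P)) Y⊑X

        -- This replaces idempotence of the ultrafilter. Syndeticity, applied to y · z with a far
        -- constant z, yields w · τ p y · z in the large set; z was chosen to agree with the limits
        -- at all finitely many candidates t · w · τ p y, so u = w · τ p y works.
        large-g : ∀ P → (∀ {t} → t ∈ P → g t ≡ i) → Large false (λ u → ∀ {t} → t ∈ P → g (t · u) ≡ i) X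
        large-g P gP Y Y⊑X with syndetic-false (large-χ Y⊑X P gP) 0
        ... | s , syn with large-far (dec (cartesianProductWith _·_ P
                              (extend false (at κ (from s)) (Y (from s)) (words s))))
                            Y⊑X (Room.next (findRoom (basic κ Y (from s))))
        ... | z , z∈ , ag with syn (append₀ (basic κ Y (from s)) z∈)
        ... | p , p≡ , p≤ , w , w∈ , hit =
          w · τ p y , append s w∈ refl (subst (λ b → Sp Y (from s) b (τ p y)) p≡
                        (substitute-true (basic κ Y (from s)) p p≤)) ,
          λ {t} t∈ → trans (sym (All.lookup ag (∈-cartesianProductWith⁺ _·_ t∈
                        (extend-new false _ y (words s) w∈ p≤ (trans (∨-identityʳ _) p≡)))))
                      (trans (cong χ (regroup t)) (hit t∈))
          where
          y = Y (from s)

          regroup : ∀ t → (t · (w · τ p y)) · z ≡ t · (w · τ p (y · z))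
          regroup t = begin
            (t · (w · τ p y)) · z   ≡⟨ assoc t _ z ⟩
            t · ((w · τ p y) · z)   ≡⟨ cong (t ·_) (assoc w _ z) ⟩
            t · (w · (τ p y · z))   ≡⟨ cong (λ u → t · (w · (τ p y · u))) (const-fixed z∈ refl p) ⟨
            t · (w · (τ p y · τ p z)) ≡⟨ cong (λ u → t · (w · u)) (τ-· p y z) ⟨
            t · (w · τ p (y · z))   ∎
            where open ≡-Reasoning

        record Fixed : Set where
          field
            prefixes : List M
            limits   : ∀ {t} → t ∈ prefixes → g t ≡ i

        -- First selection: lines in the large sets of `large-g` give a sequence on whose constant
        -- words the limit g is i.
        module Fix (gε : g ε ≡ i) where

          open Fixed

          Step : ℕ → Fixed → M → Fixed → Set
          Step n s y s′ = Grows false n (prefixes s) y (prefixes s′)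

          grow : ∀ {n l} → n ≤ l → (s : Fixed) →
                 (Σ M λ y → Sp X l true y ×
                   (∀ {q} → Positive (at κ l) q → ∀ {t} → t ∈ prefixes s → g (t · τ q y) ≡ i)) →
                 Σ M λ y → Sp X l true y × Σ Fixed λ s′ → X ⊑ X × Step n s y s′
          grow {l = l} n≤l s (y , y∈ , gy) = y , y∈ , record
            { prefixes = extend false (at κ l) y (prefixes s)
            ; limits = extend-elim false (at κ l) y (prefixes s) (λ t → g t ≡ i) (limits s)
                (λ t∈ p≤ pre → gy (positive (precedes-false pre) p≤) t∈)
            } , refines-refl , extend-grows false n≤l (prefixes s) y

          step : ∀ n (s : Fixed) l → n ≤ l → 0 ≤ l →
                 Σ M λ y → Sp X l true y × Σ Fixed λ s′ → X ⊑ X × Step n s y s′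
          step n s l n≤l _ = grow n≤l s (line (large-g (prefixes s) (limits s)) l)

          start : Fixed
          start = record { prefixes = ε ∷ [] ; limits = λ { (here refl) → gε } }

          abstract
            sequence : Fused κ (λ _ → X) (λ _ → 0) Step start
            sequence = Fusion.fused κ (λ _ → X) (λ _ → 0) Step step start

          module F = Fused sequence

          limit : ∀ {w} → Sp F.Y 0 false w → g w ≡ i
          limit w∈ with grows-closed F.related
                          (subst (λ s → ε ∈ prefixes s) (sym F.start) (here refl)) w∈ refl
          ... | N , w∈N = trans (cong g (sym (identityˡ _))) (limits (F.st N) w∈N)

          fix : Σ Seq λ Y → Y ⊑ X × (∀ {w} → Sp Y 0 false w → g w ≡ i)
          fix = F.Y , F.refines 0 , limit

        -- Second selection: with g constant on the span of Y, terms are chosen so that χ itself is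
        -- i. The field `beyond` ensures that prefixes extended by later constant words still have
        -- limit i.
        module _ (Y : Seq) (Y⊑X : Y ⊑ X) (gY : ∀ {w} → Sp Y 0 false w → g w ≡ i) (gε : g ε ≡ i) where

          record Selected : Set where
            field
              start  : ℕ
              chosen : List M
              limits : ∀ {t} → t ∈ chosen → g t ≡ i
              beyond : ∀ {t} → t ∈ chosen → ∀ {a} → Sp Y start false a → g (t · a) ≡ i

          open Selected

          module Select where
            Step : ℕ → Selected → M → Selected → Set
            Step n s e s′ = Σ (Grows false n (chosen s) e (chosen s′)) λ gr →
              ∀ {t p} → t ∈ chosen s → Positive (at κ (Grows.limit gr)) p → χ (t · τ p e) ≡ i

            grow : ∀ {n l} s → n ≤ l → start s ≤ l →
                   (Σ M λ e → Sp Y l true e ×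
                     (∀ {q} → Positive (at κ l) q → ∀ {t} → t ∈ chosen s → χ (t · τ q e) ≡ i)) →
                   Σ M λ e → Sp Y l true e × Σ Selected λ s′ → Y ⊑ Y × Step n s e s′
            grow {n} {l} s n≤l ≤l (e , e∈ , χe) = e , e∈ , record
              { start  = Room.next (findRoom e∈)
              ; chosen = extend false (at κ l) e (chosen s)
              ; limits = extend-elim false _ e (chosen s) (λ t → g t ≡ i) (limits s)
                  (λ {t} {p} t∈ p≤ pre → beyond s t∈ (down ≤l
                    (subst (λ b → Sp Y l b (τ p e)) (precedes-false pre)
                      (substitute-true e∈ p p≤))))
              ; beyond = extend-elim false _ e (chosen s)
                  (λ t → ∀ {a} → Sp Y (Room.next (findRoom e∈)) false a → g (t · a) ≡ i)
                  (λ t∈ a∈ → beyond s t∈ (down (≤-trans ≤l (<⇒≤ (Room.l<next (findRoom e∈)))) a∈))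
                  (λ {t} {p} t∈ p≤ pre {a} a∈ → trans (cong g (assoc t _ a))
                    (beyond s t∈ (down ≤l (subst (λ b → Sp Y l (b ∨ false) (τ p e · a))
                      (precedes-false pre) (append-τ e∈ p≤ a∈)))))
              } , refines-refl , extend-grows false n≤l (chosen s) e , λ t∈ p∈ → χe p∈ t∈

            step : ∀ n s l → n ≤ l → start s ≤ l →
                   Σ M λ e → Sp Y l true e × Σ Selected λ s′ → Y ⊑ Y × Step n s e s′
            step n s l n≤l ≤l = grow s n≤l ≤l (line (large-χ Y⊑X (chosen s) (limits s)) l)

            initial : Selected
            initial = record
              { start = 0 ; chosen = ε ∷ [] ; limits = λ { (here refl) → gε }
              ; beyond = λ { (here refl) a∈ → trans (cong g (identityˡ _)) (gY a∈) } }

            abstract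
              sequence : Fused κ (λ _ → Y) start Step initial
              sequence = Fusion.fused κ (λ _ → Y) start Step step initial

            module F = Fused sequence

            colour : ∀ {w} → Sp F.Y 0 false w → χ w ≡ i
            colour w∈ with grows-span (λ n → proj₁ (F.related n))
                  (subst (λ s → ε ∈ chosen s) (sym F.start) (here refl)) w∈ refl
            ... | N , s , p , s∈ , p≤ , pre , eq =
              trans (cong χ (trans (sym (identityˡ _)) eq))
                    (proj₂ (F.related N) s∈ (positive (precedes-false pre) p≤))

            select : Σ Seq λ Z → Z ⊑ Y × (∀ {w} → Sp Z 0 false w → χ w ≡ i)
            select = F.Y , F.refines 0 , colour

      abstract
        constant : ∀ {r} (χ : M → Fin r) X →
                   Σ Seq λ Y → Y ⊑ X × Σ (Fin r) λ i → ∀ {w} → Sp Y 0 false w → χ w ≡ i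
        constant χ X with decide false χ X
        -- The colour is `g ε`, the limit of χ itself.
        ... | X₁ , X₁⊑X , g , dec with Limit.Fix.fix χ g X₁ dec (g ε) refl
        ... | Y , Y⊑X₁ , gY with Limit.Select.select χ g X₁ dec (g ε) Y Y⊑X₁ gY refl
        ... | Z , Z⊑Y , χZ = Z , refines-trans Z⊑Y (refines-trans Y⊑X₁ X₁⊑X) , g ε , χZ

  -- The Hales-Jewett property by induction on the alphabet

  uniform : ℕ → Bound
  uniform m = record { at = λ _ → suc m ; mono = λ _ → ≤-refl ; pos = λ _ → s≤s z≤n }

  -- The letters are 1, …, m + 1.
  HalesJewett : ℕ → Set
  HalesJewett m = Colouring.Lines (uniform m)

  halesJewett-zero : HalesJewett 0
  halesJewett-zero l X χ = X l , basic _ X l , χ (τ 1 (X l)) , only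
    where
    only : ∀ {q} → 1 ≤ q × q ≤ 1 → χ (τ q (X l)) ≡ χ (τ 1 (X l))
    only (s≤s z≤n , s≤s z≤n) = refl

  -- With D_n = τ_{m+2}(y₀ ⋯ y_{n-1}), two of the colours of the sets D_n · (words in the letters
  -- 1, …, m+1) agree, say those for i < j; then D_i · y_i ⋯ y_{j-1} · τ_1(y_j) is a line.
  module HalesJewettStep (m : ℕ) (hj : HalesJewett m) (l : ℕ) (X : Seq) {r} (χ : M → Fin r) where

    u v : Bound
    u = uniform m
    v = uniform (suc m)

    u≼v : u ≼ v
    u≼v _ = n≤1+n _

    letter : ℕ
    letter = suc (suc m)

    -- The field `prefix` is D_n. Colours are controlled under the bound u only, while `append`
    -- needs the bound v because D_n contains the new letter.
    record Block : Set where
      field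
        seq    : Seq
        from   : ℕ
        prefix : M
        colour : Fin r
        mono   : ∀ {z} → Span u seq 0 false z → χ (prefix · z) ≡ colour
        append : ∀ {t} → Span v seq from true t → Span v X l true (prefix · t)
        fixed  : ∀ q → τ q prefix ≡ prefix

    open Block

    Coloured : Seq → M → Set
    Coloured Y D = Σ Seq λ Z → Refines u Z Y × Σ (Fin r) λ i → ∀ {z} → Span u Z 0 false z → χ (D · z) ≡ i

    abstract
      coloured : ∀ Y D → Coloured Y D
      coloured Y D = Colouring.Constant.constant u hj (λ z → χ (D · z)) Y

    start : Coloured (tail X l) ε → Block
    start (Y , Y⊑ , i , χY) = record
      { seq = Y ; from = proj₁ (Refines.shrink Y⊑ 0) ; prefix = ε ; colour = i ; mono = χY
      ; append = λ {t} t∈ → subst (Span v X l true) (sym (identityˡ t))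
          (tail-span X l (proj₂ (Refines.shrink Y⊑ 0) v u≼v t∈))
      ; fixed = τ-ε }

    Step : ℕ → Block → M → Block → Set
    Step n s y s′ = prefix s′ ≡ prefix s · τ letter y

    grow : ∀ n s j → from s ≤ j → Coloured (seq s) (prefix s · τ letter (seq s j)) →
           Σ M λ y → Span u (seq s) j true y × Σ Block λ s′ → Refines u (seq s′) (seq s) × Step n s y s′
    grow n s j ≤j (Y , Y⊑ , i , χY) = seq s j , basic u (seq s) j , record
      { seq = Y ; from = proj₁ (Refines.shrink Y⊑ next) ; prefix = prefix s · τ letter (seq s j)
      ; colour = i ; mono = χY
      ; append = λ {t} t∈ → subst (Span v X l true) (sym (assoc _ _ t)) (append s (down ≤j
          (after v u≼v letter ≤-refl (proj₂ (Refines.shrink Y⊑ next) v u≼v t∈))))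
      ; fixed = λ q → trans (τ-· q _ _) (cong₂ _·_ (fixed s q) (τ-▷ q letter _))
      } , Y⊑ , refl
      where open Room (findRoom (basic u (seq s) j)) renaming (append to after)

    step : ∀ n s j → n ≤ j → from s ≤ j →
           Σ M λ y → Span u (seq s) j true y × Σ Block λ s′ → Refines u (seq s′) (seq s) × Step n s y s′
    step n s j _ ≤j = grow n s j ≤j (coloured (seq s) (prefix s · τ letter (seq s j)))

    abstract
      sequence : Fused u seq from Step (start (coloured (tail X l) ε))
      sequence = Fusion.fused u seq from Step step (start (coloured (tail X l) ε))

    open Fused sequence using (Y; st; related; inside)

    -- With j = i + k + 1 this is y_i ⋯ y_{j-1} · τ_1(y_j). The last factor is there so that
    -- substituting the new letter leaves a constant word in the old letters after D_j.
    segment : ℕ → ℕ → M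
    segment i zero    = Y i · τ 1 (Y (suc i))
    segment i (suc k) = Y i · segment (suc i) k

    segment-span : ∀ i k → Span u Y i true (segment i k)
    segment-span i zero = subst (λ x → Span u Y i true (x · τ 1 (Y (suc i)))) (τ-zero (Y i))
      (cons 0 z≤n (last 1 (s≤s z≤n)))
    segment-span i (suc k) = subst (λ x → Span u Y i true (x · segment (suc i) k)) (τ-zero (Y i))
      (cons 0 z≤n (segment-span (suc i) k))

    telescope : ∀ i k {j} → suc k + i ≡ j →
                prefix (st i) · τ letter (segment i k) ≡ prefix (st j) · τ 1 (Y j)
    telescope i zero refl = begin
      prefix (st i) · τ letter (Y i · τ 1 (Y (suc i)))
        ≡⟨ cong (prefix (st i) ·_) (trans (τ-· letter _ _) (cong (τ letter (Y i) ·_) (τ-▷ letter 1 _))) ⟩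
      prefix (st i) · (τ letter (Y i) · τ 1 (Y (suc i)))   ≡⟨ assoc _ _ _ ⟨
      (prefix (st i) · τ letter (Y i)) · τ 1 (Y (suc i))   ≡⟨ cong (_· τ 1 (Y (suc i))) (related i) ⟨
      prefix (st (suc i)) · τ 1 (Y (suc i))                ∎
      where open ≡-Reasoning
    telescope i (suc k) {j} eq = begin
      prefix (st i) · τ letter (Y i · segment (suc i) k)            ≡⟨ cong (prefix (st i) ·_) (τ-· letter _ _) ⟩
      prefix (st i) · (τ letter (Y i) · τ letter (segment (suc i) k)) ≡⟨ assoc _ _ _ ⟨
      (prefix (st i) · τ letter (Y i)) · τ letter (segment (suc i) k) ≡⟨ cong (_· τ letter (segment (suc i) k)) (related i) ⟨
      prefix (st (suc i)) · τ letter (segment (suc i) k)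
        ≡⟨ telescope (suc i) k (trans (cong suc (+-suc k i)) eq) ⟩
      prefix (st j) · τ 1 (Y j)                                     ∎
      where open ≡-Reasoning

    st-mono : ∀ i {z} → Span u Y i false z → χ (prefix (st i) · z) ≡ colour (st i)
    st-mono i z∈ = mono (st i) (down z≤n (inside u (≼-refl u) z∈))

    segment-line : ∀ i k j → suc k + i ≡ j → colour (st i) ≡ colour (st j) →
                   ∀ {q} → 1 ≤ q × q ≤ letter → χ (prefix (st i) · τ q (segment i k)) ≡ colour (st i)
    segment-line i k j eq c≡ {suc q} (_ , q≤) with m≤n⇒m<n∨m≡n q≤
    -- An old letter gives D_i followed by a word in old letters; the new letter gives D_j ·
    -- τ_1(y_j), whose colour is the equal colour of block j.
    ... | inj₁ (s≤s q<) = st-mono i (substitute-true (segment-span i k) (suc q) q<)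
    ... | inj₂ refl = trans (cong χ (telescope i k eq))
                        (trans (st-mono j (last 1 (s≤s z≤n))) (sym c≡))

    Line : Set
    Line = Σ M λ y → Span v X l true y × Σ (Fin r) λ i → ∀ {q} → 1 ≤ q × q ≤ letter → χ (τ q y) ≡ i

    line : ∀ i j → i < j → colour (st i) ≡ colour (st j) → Line
    line i j i<j c≡ = prefix (st i) · segment i k ,
      append (st i) (inside v u≼v (relax≼ u≼v (segment-span i k))) , colour (st i) ,
      λ {q} q∈ → trans (cong χ (trans (τ-· q _ _) (cong (_· τ q (segment i k)) (fixed (st i) q))))
        (segment-line i k j (trans (sym (+-suc k i)) (m∸n+n≡m i<j)) c≡ q∈)
      where k = j ∸ suc i

    conclude : Line
    conclude with pigeonhole (n<1+n r) (λ i → colour (st (toℕ i)))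
    ... | i , j , i<j , c≡ = line (toℕ i) (toℕ j) i<j c≡

  halesJewett : ∀ m → HalesJewett m
  halesJewett zero    = halesJewett-zero
  halesJewett (suc m) = λ l X χ → HalesJewettStep.conclude m (halesJewett m) l X χ

  -- Beyond l the bound is at least κ l, so the property for the fixed alphabet 1, ..., κ l
  -- transfers.
  lines : ∀ κ → Colouring.Lines κ
  lines κ l X {r} χ = fromUniform (at κ l) refl (pos κ l)
    where
    fromUniform : ∀ m → m ≡ at κ l → 1 ≤ m → Σ M λ y → Span κ X l true y ×
                  Σ (Fin r) λ i → ∀ {q} → 1 ≤ q × q ≤ at κ l → χ (τ q y) ≡ i
    fromUniform (suc m) eq _ with halesJewett m l X χ
    ... | y , y∈ , i , mono = y , relax (λ n l≤n → subst (_≤ at κ n) (sym eq) (mono-≤ κ l≤n)) y∈ , i ,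
      λ (1≤q , q≤) → mono (1≤q , subst (_ ≤_) (sym eq) q≤)

  constant : ∀ κ {r} (χ : M → Fin r) X →
             Σ Seq λ Y → Refines κ Y X × Σ (Fin r) λ i → ∀ {w} → Span κ Y 0 false w → χ w ≡ i
  constant κ = Colouring.Constant.constant κ (lines κ)

  -- The partition theorem for variable words

  module Variable (κ : Bound) where

    open Colouring κ

    -- Here η t is the limit of χ (t · z) over constant z. Unlike in `Decides`, it is attained at
    -- every far constant word, since the theorem for constant words is already available.
    Stable : ∀ {r} → (M → Fin r) → (M → Fin r) → Seq → Set
    Stable χ η X = ∀ t → Σ ℕ λ l → ∀ {z} → Sp X l false z → χ (t · z) ≡ η t

    stable-refine : ∀ {r} {χ η : M → Fin r} {X Y} → Stable χ η X → Y ⊑ X → Stable χ η Y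
    stable-refine stab Y⊑X t with stab t
    ... | l , f with into Y⊑X l
    ... | l′ , g = l′ , λ z∈ → f (g z∈)

    -- For a far constant z′, the colour χ (t · z · z′) equals both the limit at t · z and the limit
    -- at t.
    stable-limit : ∀ {r} {χ η : M → Fin r} {X} → Stable χ η X → Stable η η X
    stable-limit {χ = χ} {η} {X} stab t = l , absorb
      where
      l = proj₁ (stab t)

      absorb : ∀ {z} → Sp X l false z → η (t · z) ≡ η t
      absorb {z} z∈ = begin
        η (t · z)          ≡⟨ proj₂ (stab (t · z)) (down (m≤n⊔m next m) z′∈) ⟨
        χ ((t · z) · z′)   ≡⟨ cong χ (assoc t z z′) ⟩
        χ (t · (z · z′))   ≡⟨ proj₂ (stab t) (append₀ z∈ (down (m≤m⊔n next m) z′∈)) ⟩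
        η t                ∎
        where
        open ≡-Reasoning
        open Room (findRoom z∈) using (next)
        m  = proj₁ (stab (t · z))
        z′ = τ 1 (X (next ⊔ m))
        z′∈ : Sp X (next ⊔ m) false z′
        z′∈ = last 1 (pos κ (next ⊔ m))

    module Stabilise {r} (χ : M → Fin r) (X : Seq) where

      Step : ℕ → Seq → M → Seq → Set
      Step n Y y Z = Σ (Fin r) λ i → ∀ {z} → Sp Z 0 false z → χ (enum n · z) ≡ i

      step : ∀ n Y l → n ≤ l → 0 ≤ l → Σ M λ y → Sp Y l true y × Σ Seq λ Z → Z ⊑ Y × Step n Y y Z
      step n Y l _ _ = Y l , basic κ Y l , constant κ (λ z → χ (enum n · z)) Y

      abstract
        sequence : Fused κ (λ Y → Y) (λ _ → 0) Step X
        sequence = Fusion.fused κ (λ Y → Y) (λ _ → 0) Step step X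

      open Fused sequence

      limit : M → Fin r
      limit t = proj₁ (related (index t))

      stable : Stable χ limit Y
      stable t with into (refines (suc (index t))) 0
      ... | l , f = l , λ {z} z∈ →
        subst (λ s → χ (s · z) ≡ limit t) (enum-index t) (proj₂ (related (index t)) (f z∈))

      stabilised : Σ Seq λ Y → Y ⊑ X × Σ (M → Fin r) λ η → Stable χ η Y
      stabilised = Y , subst (Y ⊑_) start (refines 0) , limit , stable

    module Limit {r} (χ η g : M → Fin r) (X : Seq) (stab : Stable χ η X) (dec : Decides true η g X)
                 (i : Fin r) where

      Beyond : Seq → ℕ → M → Set
      Beyond Y l t = ∀ {w} → Sp Y l false w → g (t · w) ≡ i

      Meeting : Seq → ℕ → List M → Set
      Meeting Y l P = Σ M λ e → Sp Y l true e × (∀ {t} → t ∈ P → η (t · e) ≡ i)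

      meet-after : ∀ {Y} → Y ⊑ X → ∀ P l → (∀ {t} → t ∈ P → Beyond Y l t) →
                   ∀ {w} → Sp Y l false w → Meeting Y l P
      meet-after {Y} Y⊑X P l gP {w} w∈
        with large-far (dec (map (_· w) P)) Y⊑X (Room.next (findRoom w∈))
      ... | z , z∈ , ag = w · z , append₀ w∈ z∈ , λ {t} t∈ →
        trans (cong η (sym (assoc t w z))) (trans (All.lookup ag (∈-map⁺ (_· w) t∈)) (gP t∈ w∈))

      abstract
        meet : ∀ {Y} → Y ⊑ X → ∀ P l → (∀ {t} → t ∈ P → Beyond Y l t) → Meeting Y l P
        meet Y⊑X P l gP = meet-after Y⊑X P l gP (last 1 (pos κ l))

      Extension : Seq → List M → ℕ → Set
      Extension Y P l = Σ M λ y → Sp Y l true y ×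
                        Σ Seq λ Z → Z ⊑ Y × (∀ {t} → t ∈ P → ∀ {w} → Sp Z 0 false w → g (t · (y · w)) ≡ i)

      -- By syndeticity, every far constant word u has a w among finitely many with w · x · u ∈ B in
      -- the limit; passing to a refinement makes w independent of u, and then w · x is the extension.
      module Extend (Y : Seq) (Y⊑X : Y ⊑ X) (P : List M) (gP : ∀ {t} → t ∈ P → Beyond Y 0 t) (l : ℕ) where

        B : M → Set
        B z = ∀ {t} → t ∈ P → η (t · z) ≡ i

        large : Large true B Y
        large Z Z⊑Y with into Z⊑Y 0
        ... | l′ , f with meet (refines-trans Z⊑Y Y⊑X) P l′ (λ t∈ w∈ → gP t∈ (f w∈))
        ... | e , e∈ , ηe = e , down z≤n e∈ , ηe

        -- By `stable-limit`, η ignores a far constant factor on the right, uniformly over the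
        -- finite list P.
        absorbs : Absorbs true B Y
        absorbs t′ with uniformly (λ t l → ∀ {z} → Sp Y l false z → η ((t · t′) · z) ≡ η (t · t′))
                          (λ m≤n f z∈ → f (down m≤n z∈)) P
                          (λ {t} _ → stable-limit {χ = χ} {η} (stable-refine {χ = χ} {η} stab Y⊑X) (t · t′))
        ... | l , f = l , λ _ z∈ Btz {t} t∈ →
          trans (sym (f t∈ z∈)) (trans (cong η (assoc t t′ _)) (Btz t∈))

        abstract
          syn : Σ (Prefixes true Y l) (Syndetic true B Y)
          syn = syndetic true B Y absorbs large l

        open Prefixes (proj₁ syn)

        x = Y from

        x∈ : Sp Y from true x
        x∈ = basic κ Y from

        open Room (findRoom x∈) using (next)

        Good : M → M → Set
        Good w u = ∀ {t} → t ∈ P → g (t · ((w · x) · u)) ≡ i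

        good : ∀ {u} → Sp Y next false u → Σ M λ w → w ∈ words × Good w u
        good {u} u∈ = fromHit (proj₂ syn (append₀ x∈ (append₀ u∈ (proj₁ (proj₂ far)))))
          where
          L = cartesianProductWith (λ t w → t · ((w · x) · u)) P words

          far : Σ M λ z → Sp Y (Room.next (findRoom u∈)) true z × All (λ t → η (t · z) ≡ g t) L
          far = large-far (dec L) Y⊑X (Room.next (findRoom u∈))

          z = proj₁ far

          fromHit : Hit true B (at κ from) words (x · (u · z)) → Σ M λ w → w ∈ words × Good w u
          -- The far variable word z realises the limits at all t · w · x · u, so the hit on x · u ·
          -- z becomes a statement about g.
          fromHit (zero , _ , _ , w , w∈ , Bw) = w , w∈ , λ {t} t∈ → begin
            g (t · ((w · x) · u))
              ≡⟨ All.lookup (proj₂ (proj₂ far)) (∈-cartesianProductWith⁺ (λ t w → t · ((w · x) · u)) t∈ w∈) ⟨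
            η ((t · ((w · x) · u)) · z)
              ≡⟨ cong η (trans (assoc t _ z) (cong (t ·_) (trans (assoc _ u z) (assoc w x _)))) ⟩
            η (t · (w · (x · (u · z))))
              ≡⟨ cong (λ y → η (t · (w · y))) (τ-zero _) ⟨
            η (t · (w · τ 0 (x · (u · z))))   ≡⟨ Bw t∈ ⟩
            i                                 ∎
            where open ≡-Reasoning

        Coloured : Set
        Coloured = Σ Seq λ Z → Z ⊑ tail Y next ×
                   Σ (Fin _) λ c → ∀ {u} → Sp Z 0 false u → pick Good words u ≡ c

        extension : Coloured → Extension Y P l
        extension (Z , Z⊑ , c , mono) with refine-into Z⊑ 0
        ... | Z′ , Z′⊑Z , Z′⊆Z , Z′⊆Y
          with good (down (m≤n+m next 0) (tail-span Y next (Z′⊆Y (last 1 (pos κ 0)))))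
        ... | w , w∈ , gw
          with common Good words (Sp Z′ 0 false) (λ u∈ → mono (Z′⊆Z u∈)) (last 1 (pos κ 0)) w∈ gw
        ... | v , v∈ , gv = v · x , append v∈ refl x∈ , Z′ ,
          refines-trans Z′⊑Z (refines-trans Z⊑ (tail-refines Y next)) , λ t∈ u∈ → gv u∈ t∈

        abstract
          extend-by : Extension Y P l
          extend-by = extension (constant κ (pick Good words) (tail Y next))

      Eventually : Seq → M → Set
      Eventually Y t = Σ ℕ λ l → Beyond Y l t

      record Prefixed : Set where
        field
          seq    : Seq
          seq⊑X  : seq ⊑ X
          words  : List M
          limits : ∀ {t} → t ∈ words → Beyond seq 0 t

      -- The invariant is g (t · w) = i for constant w. When t is followed by a constant instance of
      -- the new term it is inherited; when followed by the term itself it is what `Extension`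
      -- provides.
      module Fix (X₀ : Seq) (X₀⊑X : X₀ ⊑ X) (gX₀ : ∀ {w} → Sp X₀ 0 false w → g w ≡ i) where

        open Prefixed

        Step : ℕ → Prefixed → M → Prefixed → Set
        Step n s y s′ = Grows true n (words s) y (words s′)

        grow : ∀ {n l} s → n ≤ l → Extension (seq s) (words s) l →
               Σ M λ y → Sp (seq s) l true y × Σ Prefixed λ s′ → seq s′ ⊑ seq s × Step n s y s′
        grow {l = l} s n≤l (y , y∈ , Z , Z⊑ , gZ) with refine-into Z⊑ (Room.next (findRoom y∈))
        ... | Z′ , Z′⊑Z , Z′⊆Z , Z′⊆ = y , y∈ , record
          { seq = Z′
          ; seq⊑X = refines-trans Z′⊑ (seq⊑X s)
          ; words = extend true (at κ l) y (words s)
          ; limits = extend-elim true (at κ l) y (words s) (Beyond Z′ 0)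
              (λ t∈ w∈ → limits s t∈ (down z≤n (Z′⊆ w∈))) (λ {t} {p} t∈ p≤ _ → new p t∈ p≤)
          } , Z′⊑ , extend-grows true n≤l (words s) y
          where
          Z′⊑ = refines-trans Z′⊑Z Z⊑

          new : ∀ p {t} → t ∈ words s → p ≤ at κ l → Beyond Z′ 0 (t · τ p y)
          new zero {t} t∈ _ {w} w∈ =
            trans (cong g (trans (assoc t _ w) (cong (λ x → t · (x · w)) (τ-zero y)))) (gZ t∈ (Z′⊆Z w∈))
          new (suc p) {t} t∈ p≤ {w} w∈ =
            trans (cong g (assoc t _ w)) (limits s t∈ (down z≤n (append-τ y∈ p≤ (Z′⊆ w∈))))

        step : ∀ n s l → n ≤ l → 0 ≤ l →
               Σ M λ y → Sp (seq s) l true y × Σ Prefixed λ s′ → seq s′ ⊑ seq s × Step n s y s′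
        step n s l n≤l _ = grow s n≤l (Extend.extend-by (seq s) (seq⊑X s) (words s) (limits s) l)

        initial : Prefixed
        initial = record
          { seq = X₀ ; seq⊑X = X₀⊑X ; words = ε ∷ []
          ; limits = λ { (here refl) w∈ → trans (cong g (identityˡ _)) (gX₀ w∈) } }

        abstract
          sequence : Fused κ seq (λ _ → 0) Step initial
          sequence = Fusion.fused κ seq (λ _ → 0) Step step initial

        open Fused sequence

        eventually : ∀ n {t} → t ∈ words (st n) → Eventually Y t
        eventually n t∈ with into (refines n) 0
        ... | l , f = l , λ w∈ → limits (st n) t∈ (f w∈)

        ε∈ : ε ∈ words (st 0)
        ε∈ = subst (λ s → ε ∈ words s) (sym start) (here refl)

        span-eventually : ∀ {c a} → Sp Y 0 c a → Eventually Y a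
        span-eventually {c} {a} a∈ with grows-closed {P = λ n → words (st n)} related ε∈ a∈ refl
        ... | N , εa∈ = subst (Eventually Y) (identityˡ a) (eventually N εa∈)

        fix : Σ Seq λ Y → Y ⊑ X × Eventually Y ε × (∀ {c a} → Sp Y 0 c a → Eventually Y a)
        fix = Y , refines-trans (refines 0) (seq⊑X (st 0)) , eventually 0 ε∈ , span-eventually

      module Select (Y : Seq) (Y⊑X : Y ⊑ X) (ev-ε : Eventually Y ε)
                    (ev : ∀ {c a} → Sp Y 0 c a → Eventually Y a) where

        record Selected : Set where
          field
            from   : ℕ
            chosen : List M
            limits : ∀ {t} → t ∈ chosen → Eventually Y t
            beyond : ∀ {t} → t ∈ chosen → ∀ {c a} → Sp Y from c a → Eventually Y (t · a)

        open Selected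

        χ-stable : Stable χ η Y
        χ-stable = stable-refine {χ = χ} {η} stab Y⊑X

        -- The second half covers products in which u is the last variable factor and constant
        -- factors follow.
        Good : List M → M → ℕ → Set
        Good P u m = ∀ {t} → t ∈ P → χ (t · u) ≡ i × (∀ {z} → Sp Y m false z → χ (t · (u · z)) ≡ i)

        Choice : List M → ℕ → Set
        Choice P l = Σ M λ u → Sp Y l true u × Σ ℕ λ m → Good P u m

        -- The factor τ₁(Y m) brings the colour χ to its limit value η.
        settle : ∀ {P l} → Meeting Y l P → Choice P l
        settle {P} {l} (e , e∈ , ηe)
          with uniformly (λ t m → ∀ {z} → Sp Y m false z → χ ((t · e) · z) ≡ i)
                 (λ m≤n f z∈ → f (down m≤n z∈)) P
                 (λ {t} t∈ → proj₁ (χ-stable (t · e)) ,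
                             λ z∈ → trans (proj₂ (χ-stable (t · e)) z∈) (ηe t∈))
        ... | k , f = e · e′ , append₀ e∈ (down (m≤m⊔n _ k) e′∈) , Room.next (findRoom e′∈) ,
          λ {t} t∈ → trans (cong χ (sym (assoc t e e′))) (f t∈ (down (m≤n⊔m _ k) e′∈)) ,
            λ {z} z∈ → trans (cong χ (trans (cong (t ·_) (assoc e e′ z)) (sym (assoc t e (e′ · z)))))
              (f t∈ (down (m≤n⊔m _ k) (append₀ e′∈ z∈)))
          where
          m = Room.next (findRoom e∈) ⊔ k
          e′ = τ 1 (Y m)
          e′∈ : Sp Y m false e′
          e′∈ = last 1 (pos κ m)

        choose : ∀ P l → (∀ {t} → t ∈ P → Eventually Y t) → Choice P l
        choose P l evP with uniformly (λ t m → Beyond Y m t) (λ m≤n f w∈ → f (down m≤n w∈)) P evP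
        ... | k , f with settle (meet Y⊑X P (l ⊔ k) (λ t∈ w∈ → f t∈ (down (m≤n⊔m l k) w∈)))
        ... | u , u∈ , good = u , down (m≤m⊔n l k) u∈ , good

        Step : ℕ → Selected → M → Selected → Set
        Step n s u s′ = Grows true n (chosen s) u (chosen s′) × Good (chosen s) u (from s′)

        grow : ∀ {n l} s → n ≤ l → from s ≤ l → Choice (chosen s) l →
               Σ M λ u → Sp Y l true u × Σ Selected λ s′ → Y ⊑ Y × Step n s u s′
        grow {n} {l} s n≤l ≤l (u , u∈ , m , good) = u , u∈ , record
          { from   = next ⊔ m
          ; chosen = extend true (at κ l) u (chosen s)
          ; limits = extend-elim true (at κ l) u (chosen s) (Eventually Y) (limits s)
              (λ {t} {p} t∈ p≤ _ → beyond s t∈ (down ≤l (substitute-true u∈ p p≤)))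
          ; beyond = extend-elim true (at κ l) u (chosen s)
              (λ t → ∀ {c a} → Sp Y (next ⊔ m) c a → Eventually Y (t · a))
              (λ t∈ a∈ → beyond s t∈ (down (≤-trans ≤l (≤-trans (<⇒≤ l<next) (m≤m⊔n next m))) a∈))
              (λ {t} {p} t∈ p≤ _ {c} {a} a∈ → subst (Eventually Y) (sym (assoc t _ a))
                (beyond s t∈ (down ≤l (append-τ u∈ p≤ (down (m≤m⊔n next m) a∈)))))
          } , refines-refl , extend-grows true n≤l (chosen s) u ,
          λ t∈ → proj₁ (good t∈) , λ z∈ → proj₂ (good t∈) (down (m≤n⊔m next m) z∈)
          where open Room (findRoom u∈) using (next; l<next)

        step : ∀ n s l → n ≤ l → from s ≤ l →
               Σ M λ u → Sp Y l true u × Σ Selected λ s′ → Y ⊑ Y × Step n s u s′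
        step n s l n≤l ≤l = grow s n≤l ≤l (choose (chosen s) l (limits s))

        initial : Selected
        initial = record
          { from = 0 ; chosen = ε ∷ [] ; limits = λ { (here refl) → ev-ε }
          ; beyond = λ { (here refl) a∈ → subst (Eventually Y) (sym (identityˡ _)) (ev a∈) } }

        abstract
          sequence : Fused κ (λ _ → Y) from Step initial
          sequence = Fusion.fused κ (λ _ → Y) from Step step initial

        open Fused sequence renaming (Y to U)

        -- Factors move into the prefix up to the last one with letter 0; the rest is constant or
        -- absent, and `Good` applies.
        colour : ∀ {n c t a} → t ∈ chosen (st n) → Sp U n c a → c ≡ true → χ (t · a) ≡ i
        colour {n} {t = t} t∈ (last zero _) _ =
          trans (cong (λ u → χ (t · u)) (τ-zero (U n))) (proj₁ (proj₂ (related n) t∈))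
        colour {n} t∈ (skip a∈) c≡ = colour (Grows.old (proj₁ (related n)) t∈) a∈ c≡
        colour {n} {t = t} t∈ (cons {b = true} {w = a} p p≤ a∈) c≡ =
          trans (cong χ (sym (assoc t _ a)))
            (colour (Grows.new gr t∈ (≤-trans p≤ (mono-≤ κ (Grows.n≤ gr))) (∨-zeroʳ (isVar p))) a∈ refl)
          where gr = proj₁ (related n)
        colour {n} {t = t} t∈ (cons {b = false} {w = a} zero p≤ a∈) c≡ =
          trans (cong (λ u → χ (t · (u · a))) (τ-zero (U n)))
            (proj₂ (proj₂ (related n) t∈) (inside κ (≼-refl κ) a∈))

        select : Σ Seq λ U → U ⊑ Y × (∀ {a} → Sp U 0 true a → χ a ≡ i)
        select = U , refines 0 , λ {a} a∈ → trans (cong χ (sym (identityˡ a)))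
          (colour (subst (λ s → ε ∈ chosen s) (sym start) (here refl)) a∈ refl)

    abstract
      variable-words : ∀ {r} (χ : M → Fin r) X →
                       Σ Seq λ U → U ⊑ X × Σ (Fin r) λ i → ∀ {a} → Sp U 0 true a → χ a ≡ i
      variable-words χ X with Stabilise.stabilised χ X
      ... | X₁ , X₁⊑X , η , stab with decide true η X₁
      ... | X₂ , X₂⊑X₁ , g , dec with constant κ g X₂
      -- This fixes the final colour: i is the common value of g on the constant words of `X₃`.
      ... | X₃ , X₃⊑X₂ , i , gX₃
        with Limit.Fix.fix χ η g X₂ (stable-refine {χ = χ} {η} stab X₂⊑X₁) dec i X₃ X₃⊑X₂ gX₃
      ... | Y , Y⊑X₂ , ev-ε , ev
        with Limit.Select.select χ η g X₂ (stable-refine {χ = χ} {η} stab X₂⊑X₁) dec i Y Y⊑X₂ ev-ε ev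
      ... | U , U⊑Y , χU =
        U , refines-trans U⊑Y (refines-trans Y⊑X₂ (refines-trans X₂⊑X₁ X₁⊑X)) , i , χU

  -- Spacing of the terms and the simultaneous partition theorem

  -- Each term is chosen beyond an index determined by the size of its predecessor; for words and
  -- their lengths this yields the relation `≺`.
  module Spacing (κ : Bound) (size : M → ℕ) (X Y : Seq) (Y⊑X : Refines κ Y X) where

    open Colouring κ using (Sp; into)

    Step : ℕ → ℕ → M → ℕ → Set
    Step _ _ y m = ∀ {b w} → Sp Y m b w → Sp X (size y) b w

    step : ∀ n m l → n ≤ l → m ≤ l → Σ M λ y → Sp Y l true y × Σ ℕ λ m′ → Refines κ Y Y × Step n m y m′
    step _ _ l _ _ = Y l , basic κ Y l , proj₁ (into Y⊑X (size (Y l))) , refines-refl ,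
                     proj₂ (into Y⊑X (size (Y l)))

    abstract
      sequence : Fused κ (λ _ → Y) (λ m → m) Step (proj₁ (into Y⊑X 0))
      sequence = Fusion.fused κ (λ _ → Y) (λ m → m) Step step (proj₁ (into Y⊑X 0))

    open Fused sequence renaming (Y to Z)

    spaced : Σ Seq λ Z → (∀ {b w} → Sp Z 0 b w → Sp Y 0 b w) × (∀ {b w} → Sp Z 0 b w → Sp X 0 b w) ×
             (∀ n {b w} → Sp Z (suc n) b w → Sp X (size (Z n)) b w)
    spaced = Z , (λ s → down z≤n (inside κ (≼-refl κ) s)) ,
      (λ {b} {w} s → proj₂ (into Y⊑X 0) (subst (λ m → Sp Y m b w) start (inside κ (≼-refl κ) s))) ,
      λ n s → related n (inside κ (≼-refl κ) s)

  partition : ∀ κ {r s} (χ : M → Fin r) (ψ : M → Fin s) (size : M → ℕ) X →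
              Σ Seq λ Z → Σ (Fin r) λ i → Σ (Fin s) λ j →
              (∀ {w} → Span κ Z 0 true w → χ w ≡ i) × (∀ {w} → Span κ Z 0 false w → ψ w ≡ j) ×
              (∀ {b w} → Span κ Z 0 b w → Span κ X 0 b w) ×
              (∀ n {b w} → Span κ Z (suc n) b w → Span κ X (size (Z n)) b w)
  partition κ χ ψ size X with constant κ ψ X
  ... | X₁ , X₁⊑X , j , ψX₁ with Variable.variable-words κ χ X₁
  ... | U , U⊑X₁ , i , χU with refine-into U⊑X₁ 0
  ... | V , V⊑U , V⊆U , V⊆X₁
    with Spacing.spaced κ size X V (refines-trans V⊑U (refines-trans U⊑X₁ X₁⊑X))
  ... | Z , Z⊆V , Z⊆X , Z-spaced = Z , i , j , (λ w∈ → χU (V⊆U (Z⊆V w∈))) , (λ w∈ → ψX₁ (V⊆X₁ (Z⊆V w∈))) ,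
    Z⊆X , Z-spaced

-- Words as a substitution monoid

⋆-identityʳ : ∀ w → w ⋆ [] ≡ w
⋆-identityʳ w = trans (cong (w ++_) (drop-[] (length w))) (++-identityʳ w)

-- Under either bracketing, each position is filled by the leftmost word long enough to reach it.
⋆-assoc : ∀ w u x → (w ⋆ u) ⋆ x ≡ w ⋆ (u ⋆ x)
⋆-assoc []      u       x       = refl
⋆-assoc (a ∷ w) []      x       = cong (_⋆ x) (⋆-identityʳ (a ∷ w))
⋆-assoc (a ∷ w) (b ∷ u) []      =
  trans (⋆-identityʳ ((a ∷ w) ⋆ (b ∷ u))) (cong ((a ∷ w) ⋆_) (sym (⋆-identityʳ (b ∷ u))))
⋆-assoc (a ∷ w) (b ∷ u) (c ∷ x) = cong (a ∷_) (⋆-assoc w u x)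

Tgo-⋆ : ∀ k p i w u → Tgo k p i (w ⋆ u) ≡ Tgo k p i w ⋆ Tgo k p i u
Tgo-⋆ k p i []        u       = refl
Tgo-⋆ k p i (a ∷ w)   []      =
  trans (cong (Tgo k p i) (⋆-identityʳ (a ∷ w))) (sym (⋆-identityʳ (Tgo k p i (a ∷ w))))
Tgo-⋆ k p i (υ ∷ w)   (υ ∷ u)   = cong (_ ∷_) (Tgo-⋆ k p (suc i) w u)
Tgo-⋆ k p i (υ ∷ w)   (α _ ∷ u) = cong (_ ∷_) (Tgo-⋆ k p (suc i) w u)
Tgo-⋆ k p i (α m ∷ w) (υ ∷ u)   = cong (α m ∷_) (Tgo-⋆ k p (suc i) w u)
Tgo-⋆ k p i (α m ∷ w) (α _ ∷ u) = cong (α m ∷_) (Tgo-⋆ k p (suc i) w u)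

Tgo-Tgo : ∀ k q p i w → Tgo k q i (Tgo k p i w) ≡ Tgo k p i w
Tgo-Tgo k q p i []        = refl
Tgo-Tgo k q p i (υ ∷ w) with p ≤ᵇ k i
... | true  = cong (α p ∷_) (Tgo-Tgo k q p (suc i) w)
... | false = cong (α (k i) ∷_) (Tgo-Tgo k q p (suc i) w)
Tgo-Tgo k q p i (α m ∷ w) = cong (α m ∷_) (Tgo-Tgo k q p (suc i) w)

-- For reading numerals as words: the digit `2[1+_]` puts υ in front, and `1+[2_]` moves the first
-- letter one step along υ, α 0, α 1, ....
increment : Word → Word
increment []        = []
increment (υ ∷ w)   = α 0 ∷ w
increment (α m ∷ w) = α (suc m) ∷ w

decode : ℕᵇ → Word
decode Bin.zero    = []
decode Bin.2[1+ b ] = υ ∷ decode b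
decode Bin.1+[2 b ] = increment (decode b)

encodeα : ℕ → ℕᵇ → ℕᵇ
encodeα zero    b = Bin.1+[2 Bin.2[1+ b ] ]
encodeα (suc m) b = Bin.1+[2 encodeα m b ]

encode : Word → ℕᵇ
encode []        = Bin.zero
encode (υ ∷ w)   = Bin.2[1+ encode w ]
encode (α m ∷ w) = encodeα m (encode w)

decode-encodeα : ∀ m b → decode (encodeα m b) ≡ α m ∷ decode b
decode-encodeα zero    b = refl
decode-encodeα (suc m) b = cong increment (decode-encodeα m b)

decode-encode : ∀ w → decode (encode w) ≡ w
decode-encode []        = refl
decode-encode (υ ∷ w)   = cong (υ ∷_) (decode-encode w)
decode-encode (α m ∷ w) = trans (decode-encodeα m (encode w)) (cong (α m ∷_) (decode-encode w))

-- The operation ⋆ is associative on all words, although the paper uses it only for w < u.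
words : (ℕ → ℕ) → SubstitutionMonoid
words k = record
  { Carrier = Word ; _·_ = _⋆_ ; ε = [] ; τ = T k
  ; assoc = ⋆-assoc ; identityˡ = λ _ → refl ; τ-zero = λ _ → refl
  ; τ-ε = λ { zero → refl ; (suc _) → refl }
  ; τ-· = λ { zero _ _ → refl ; (suc p) w u → Tgo-⋆ k (suc p) 0 w u }
  ; τ-▷ = λ { q zero w → refl ; zero (suc p) w → refl ; (suc q) (suc p) w → Tgo-Tgo k (suc q) (suc p) 0 w }
  ; enum = λ n → decode (Bin.fromℕ n) ; index = λ w → Bin.toℕ (encode w)
  ; enum-index = λ w → trans (cong decode (fromℕ-toℕ (encode w))) (decode-encode w)
  }

-- The span of the generators and the words over the alphabet

module Words (em : ExcludedMiddle 0ℓ) (κ : Bound) where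

  k : ℕ → ℕ
  k = at κ

  open Ramsey (words k) em

  -- The only free position is n; the copies of α 1 before it are overwritten by earlier factors of
  -- a `⋆`-product.
  generator : Seq
  generator n = replicate n (α 1) ++ υ ∷ []

  data At (l : ℕ) : Bool → Letter → Set where
    variable′ : At l true υ
    letter    : ∀ {m} → 1 ≤ m → m ≤ k l → At l false (α m)

  data Filled : ℕ → Bool → Word → Set where
    [_] : ∀ {l b a} → At l b a → Filled l b (a ∷ [])
    _∷_ : ∀ {l b c a w} → At l b a → Filled (suc l) c w → Filled l (b ∨ c) (a ∷ w)

  replicate-shift : ∀ l (v : Word) → α 1 ∷ replicate l (α 1) ++ v ≡ replicate l (α 1) ++ α 1 ∷ v
  replicate-shift zero    v = refl
  replicate-shift (suc l) v = cong (α 1 ∷_) (replicate-shift l v)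

  Tgo-generator : ∀ p i l → Tgo k p i (generator l) ≡
                  replicate l (α 1) ++ (if p ≤ᵇ k (l + i) then α p else α (k (l + i))) ∷ []
  Tgo-generator p i zero    = refl
  Tgo-generator p i (suc l) = cong (α 1 ∷_) (trans (Tgo-generator p (suc i) l)
    (cong (λ n → replicate l (α 1) ++ (if p ≤ᵇ k n then α p else α (k n)) ∷ []) (+-suc l i)))

  τ-generator : ∀ l p → p ≤ k l →
                Σ Letter λ a → T k p (generator l) ≡ replicate l (α 1) ++ a ∷ [] × At l (isVar p) a
  τ-generator l zero    _  = υ , refl , variable′
  τ-generator l (suc p) p≤ = α (suc p) , trans (Tgo-generator (suc p) 0 l) (cong (λ a → replicate l (α 1) ++ a ∷ [])
    (begin
      (if suc p ≤ᵇ k (l + 0) then α (suc p) else α (k (l + 0)))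
        ≡⟨ cong (λ n → if suc p ≤ᵇ k n then α (suc p) else α (k n)) (+-identityʳ l) ⟩
      (if suc p ≤ᵇ k l then α (suc p) else α (k l))
        ≡⟨ cong (λ b → if b then α (suc p) else α (k l)) (T-≡ .Equivalence.to (≤⇒≤ᵇ p≤)) ⟩
      α (suc p) ∎)) , letter (s≤s z≤n) p≤
    where open ≡-Reasoning

  overwrite : ∀ l a (v : Word) →
              (replicate l (α 1) ++ a ∷ []) ⋆ (replicate (suc l) (α 1) ++ v) ≡ replicate l (α 1) ++ a ∷ v
  overwrite zero    a v = refl
  overwrite (suc l) a v = cong (α 1 ∷_) (overwrite l a v)

  -- An index skipped in the product is a position that keeps the padding letter α 1 of a later
  -- generator.
  span-word : ∀ {l b w} → Span κ generator l b w → Σ Word λ v → w ≡ replicate l (α 1) ++ v × Filled l b v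
  span-word (last {l} p p≤) with τ-generator l p p≤
  ... | a , eq , a-at = a ∷ [] , eq , [ a-at ]
  span-word (skip {l} s) with span-word s
  ... | v , eq , filled = α 1 ∷ v , trans eq (replicate-shift l v) , letter ≤-refl (pos κ l) ∷ filled
  span-word (cons {l} p p≤ s) with τ-generator l p p≤ | span-word s
  ... | a , eq , a-at | v , eq′ , filled =
    a ∷ v , trans (cong₂ _⋆_ eq eq′) (overwrite l a v) , a-at ∷ filled

  VLetter-at : ∀ {l b a} → At l b a → VLetter (k l) a
  VLetter-at variable′      = tt
  VLetter-at (letter 1≤ ≤k) = 1≤ , ≤k

  ΣLetter-at : ∀ {l b a} → At l b a → b ≡ false → ΣLetter (k l) a
  ΣLetter-at (letter 1≤ ≤k) _ = 1≤ , ≤k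

  filled-V : ∀ {l b w} → Filled l b w → ∀ i {n} → toℕ i + l ≡ n → VLetter (k n) (lookup w i)
  filled-V [ a ]        zero    refl = VLetter-at a
  filled-V (a ∷ filled) zero    refl = VLetter-at a
  filled-V (a ∷ filled) (suc i) eq   = filled-V filled i (trans (+-suc (toℕ i) _) eq)

  filled-Σ : ∀ {l b w} → Filled l b w → b ≡ false → ∀ i {n} → toℕ i + l ≡ n → ΣLetter (k n) (lookup w i)
  filled-Σ [ a ]                         b≡ zero    refl = ΣLetter-at a b≡
  filled-Σ (a@(letter _ _) ∷ filled)     b≡ zero    refl = ΣLetter-at a refl
  filled-Σ ((letter _ _) ∷ filled)       b≡ (suc i) eq   = filled-Σ filled b≡ i (trans (+-suc (toℕ i) _) eq)

  filled-υ : ∀ {l b w} → Filled l b w → b ≡ true → Σ (Fin (length w)) λ i → lookup w i ≡ υ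
  filled-υ [ variable′ ]           _  = zero , refl
  filled-υ (variable′ ∷ filled)    _  = zero , refl
  filled-υ (letter _ _ ∷ filled)   b≡ with filled-υ filled b≡
  ... | i , eq = suc i , eq

  filled-nonempty : ∀ {l b w} → Filled l b w → 1 ≤ length w
  filled-nonempty [ _ ]   = s≤s z≤n
  filled-nonempty (_ ∷ _) = s≤s z≤n

  span-InWv : ∀ {w} → Span κ generator 0 true w → InWv k w
  span-InWv s with span-word s
  ... | _ , refl , filled = (λ i → filled-V filled i (+-identityʳ (toℕ i))) , filled-υ filled refl

  span-InW : ∀ {w} → Span κ generator 0 false w → InW k w
  span-InW s with span-word s
  ... | _ , refl , filled = filled-nonempty filled , λ i → filled-Σ filled refl i (+-identityʳ (toℕ i))

  lookup-replicate : ∀ l v (i : Fin (length (replicate l (α 1) ++ v))) → toℕ i < l →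
                     lookup (replicate l (α 1) ++ v) i ≡ α 1
  lookup-replicate (suc l) v zero    _         = refl
  lookup-replicate (suc l) v (suc i) (s≤s i<l) = lookup-replicate l v i i<l

  span-≺ : ∀ {b w} u → Span κ generator (length u) b w → u ≺ w
  span-≺ u s with span-word s
  ... | v , refl , filled =
    subst (length u <_) (sym (trans (length-++ (replicate (length u) (α 1)))
        (cong (_+ length v) (length-replicate (length u)))))
      (m<m+n (length u) (filled-nonempty filled)) ,
    lookup-replicate (length u) v

  -- Reconciles `combine`, bracketed to the left, with `Span`, bracketed to the right.
  foldl-⋆ : ∀ (f : ℕ × ℕ → Word) x y qs →
            foldl (λ acc q → acc ⋆ f q) (x ⋆ y) qs ≡ x ⋆ foldl (λ acc q → acc ⋆ f q) y qs
  foldl-⋆ f x y []       = refl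
  foldl-⋆ f x y (q ∷ qs) = trans (cong (λ z → foldl (λ acc q → acc ⋆ f q) z qs) (⋆-assoc x y (f q)))
                                 (foldl-⋆ f x (y ⋆ f q) qs)

  hasVar : List (ℕ × ℕ) → Bool
  hasVar []            = false
  hasVar ((_ , p) ∷ q) = isVar p ∨ hasVar q

  hasVar-true : ∀ {q} → Any (λ q → proj₂ q ≡ 0) q → hasVar q ≡ true
  hasVar-true {(_ , zero)  ∷ q} _          = refl
  hasVar-true {(_ , suc _) ∷ q} (there q∈) = hasVar-true q∈

  hasVar-false : ∀ {q} → All (λ q → 1 ≤ proj₂ q × proj₂ q ≤ k (proj₁ q)) q → hasVar q ≡ false
  hasVar-false []                             = refl
  hasVar-false {(_ , suc _) ∷ _} (_ ∷ qs) = hasVar-false qs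

  combine-span : ∀ u n p q → Linked (λ a b → proj₁ a < proj₁ b) ((n , p) ∷ q) →
                 All (λ q → proj₂ q ≤ k (proj₁ q)) ((n , p) ∷ q) →
                 Span κ u n (hasVar ((n , p) ∷ q)) (combine k u ((n , p) ∷ q))
  combine-span u n p [] _ (p≤ ∷ _) =
    subst (λ b → Span κ u n b (T k p (u n))) (sym (∨-identityʳ (isVar p))) (last p p≤)
  combine-span u n p ((n′ , p′) ∷ q) (n<n′ ∷ linked) (p≤ ∷ bounds) =
    subst (Span κ u n (hasVar ((n , p) ∷ (n′ , p′) ∷ q)))
      (sym (foldl-⋆ (λ q → T k (proj₂ q) (u (proj₁ q))) (T k p (u n)) (T k p′ (u n′)) q))
      (cons p p≤ (down n<n′ (combine-span u n′ p′ q linked bounds)))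

  Increasing : List (ℕ × ℕ) → Set
  Increasing = Linked (λ a b → proj₁ a < proj₁ b)

  combine-true : ∀ u np → 1 ≤ length np → Increasing np → All (λ q → proj₂ q ≤ k (proj₁ q)) np →
                 Any (λ q → proj₂ q ≡ 0) np → Span κ u 0 true (combine k u np)
  combine-true u ((n , p) ∷ q) _ linked bounds var =
    subst (λ b → Span κ u 0 b (combine k u ((n , p) ∷ q))) (hasVar-true var)
      (down z≤n (combine-span u n p q linked bounds))

  combine-false : ∀ u np → 1 ≤ length np → Increasing np →
                  All (λ q → 1 ≤ proj₂ q × proj₂ q ≤ k (proj₁ q)) np → Span κ u 0 false (combine k u np)
  combine-false u ((n , p) ∷ q) _ linked bounds =
    subst (λ b → Span κ u 0 b (combine k u ((n , p) ∷ q))) (hasVar-false bounds)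
      (down z≤n (combine-span u n p q linked (All.map proj₂ bounds)))

  -- Colourings from coverings, and the theorem

  module Choice {r} (In : Word → Set) (A : Fin r → Word → Set)
                (cover : ∀ w → In w → Σ (Fin r) λ i → A i w) (w₀ : Word) (in₀ : In w₀) where

    colour : Word → Fin r
    colour w with em {In w}
    ... | yes w∈ = proj₁ (cover w w∈)
    -- A default colour outside the covered set; the word `w₀` guarantees that some colour exists.
    ... | no  _  = proj₁ (cover w₀ in₀)

    correct : ∀ {w} → In w → A (colour w) w
    correct {w} w∈ with em {In w}
    ... | yes w∈′ = proj₂ (cover w w∈′)
    ... | no  w∉  = contradiction w∈ w∉

theorem1p5 : ExcludedMiddle 0ℓ →
    (k : ℕ → ℕ) → ((n : ℕ) → 1 ≤ k n) → ((n : ℕ) → k n ≤ k (suc n)) →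
    (r s : ℕ) → (A : Fin r → Word → Set) → (C : Fin s → Word → Set) →
    ((w : Word) → InWv k w → Σ (Fin r) (λ i → A i w)) →
    ((w : Word) → InW k w → Σ (Fin s) (λ j → C j w)) →
    Σ (ℕ → Word) (λ u → InW∞ k u × Σ (Fin r) (λ i₀ → Σ (Fin s) (λ j₀ →
    ((np : List (ℕ × ℕ)) → 1 ≤ length np →
    Linked (λ a b → proj₁ a < proj₁ b) np →
    All (λ q → proj₂ q ≤ k (proj₁ q)) np →
    Any (λ q → proj₂ q ≡ 0) np →
    A i₀ (combine k u np))
    ×
    ((np : List (ℕ × ℕ)) → 1 ≤ length np →
    Linked (λ a b → proj₁ a < proj₁ b) np →
    All (λ q → 1 ≤ proj₂ q × proj₂ q ≤ k (proj₁ q)) np →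
    C j₀ (combine k u np)))))
theorem1p5 em k k-pos k-mono r s A C coverA coverC =
  -- With `length` as size, each term lies in the span of the generators from the length of its
  -- predecessor on.
  let u , i , j , χu , ψu , u⊆ , spaced = partition κ χ.colour ψ.colour length generator in
  u ,
  ((λ n → span-InWv (u⊆ (down z≤n (basic κ u n)))) , λ n → span-≺ (u n) (spaced n (basic κ u (suc n)))) ,
  i , j ,
  (λ np ne linked bounds var →
    let w∈ = combine-true u np ne linked bounds var
    in subst (λ i → A i (combine k u np)) (χu w∈) (χ.correct (span-InWv (u⊆ w∈)))) ,
  (λ np ne linked bounds →
    let w∈ = combine-false u np ne linked bounds
    in subst (λ j → C j (combine k u np)) (ψu w∈) (ψ.correct (span-InW (u⊆ w∈))))
  where
  κ : Bound
  κ = record { at = k ; mono = k-mono ; pos = k-pos }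

  open Words em κ hiding (k)
  open Ramsey (words k) em

  module χ = Choice (InWv k) A coverA (generator 0) (span-InWv (basic κ generator 0))
  module ψ = Choice (InW k) C coverC (T k 1 (generator 0)) (span-InW (last 1 (k-pos 0)))
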